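{- Let $\pi(\mathcal{H}(r))$ denote the Turán density of the $r$-triangle $\mathcal{H}(r)$. Then $$\frac{9}{64} \le \pi(\mathcal{H}(6)), \qquad \frac{35}{2^{11}} \le \pi(\mathcal{H}(7)), \qquad \frac{315}{2^{14}} \le \pi(\mathcal{H}(8)).$$ Moreover, there exists a $5$-$(12,6,2)$ design with the property that any set of $7$ vertices spans $0$ or $2$ edges, and consequently $\operatorname{ex}(\mathcal{H}(6),12)=264$.
   Context: For $r\ge 2$, an $r$-graph is an $r$-uniform hypergraph. The $r$-triangle $\mathcal{H}(r)$ is the (unique up to isomorphism) $r$-graph on $r+1$ vertices with exactly $3$ edges. For an $r$-graph $\mathcal{H}$ and integer $n$, $\operatorname{ex}(\mathcal{H},n)$ is the maximum number of edges in an $r$-graph on $n$ vertices containing no copy of $\mathcal{H}$, and the Turán density is $\pi(\mathcal{H})=\lim_{n\to\infty}\operatorname{ex}(\mathcal{H},n)\binom{n}{r}^{ -1}$. A $t$-$(n,k,\lambda)$ design is a $k$-graph on $n$ vertices in which every set of $t$ vertices is contained in exactly $\lambda$ edges. A set $S$ of vertices spans $m$ edges if exactly $m$ edges are contained in $S$. -}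

module Defs where

open import Data.Nat using (ℕ; zero; suc; _+_; _*_; _∸_; _≤_; _≥_)
open import Data.Nat.Combinatorics using (_C_)
open import Data.Bool using (if_then_else_)
open import Data.Fin using (Fin; zero; suc)
open import Data.Fin.Subset using (Subset; ⁅_⁆; ∁; ⋃; ⊥; ∣_∣; _⊆_)
open import Data.Fin.Subset.Properties using (_⊆?_; ∣∁p∣≡n∸∣p∣; ∣⁅x⁆∣≡1)
open import Data.Vec using (lookup)
open import Data.List using (List; []; _∷_; length; filter; map; allFin)
open import Data.List.Relation.Unary.All using (All; []; _∷_)
open import Data.List.Relation.Unary.Unique.Propositional using (Unique)
open import Data.List.Relation.Unary.AllPairs using ([]; _∷_)
open import Data.List.Membership.Propositional using (_∈_)
open import Data.Product using (Σ; _×_; _,_)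
open import Function.Definitions using (Injective)
open import Relation.Binary.PropositionalEquality using (_≡_; refl; trans; cong)

record RGraph (r n : ℕ) : Set where
  constructor mkRGraph
  field
    edges    : List (Subset n)
    distinct : Unique edges
    uniform  : All (λ e → ∣ e ∣ ≡ r) edges
open RGraph public

numEdges : ∀ {r n} → RGraph r n → ℕ
numEdges G = length (edges G)

image : ∀ {m n} → (Fin m → Fin n) → Subset m → Subset n
image {m} f e = ⋃ (map (λ i → if lookup e i then ⁅ f i ⁆ else ⊥) (allFin m))

ContainsCopy : ∀ {r m n} → RGraph r n → RGraph r m → Set
ContainsCopy {r} {m} {n} G F =
  Σ (Fin m → Fin n) λ f → Injective _≡_ _≡_ f × All (λ e → image f e ∈ edges G) (edges F)

Free : ∀ {r m n} → RGraph r m → RGraph r n → Set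
Free F G = ContainsCopy G F → Data.Empty.⊥
  where import Data.Empty

-- The r-triangle H(r) for r = k + 2: vertex set Fin (k + 3), and edges
-- the complements of the singletons {0}, {1}, {2}
-- (r + 1 vertices, exactly 3 edges).
triangle : (k : ℕ) → RGraph (suc (suc k)) (suc (suc (suc k)))
triangle k = mkRGraph es dist unif
  where
  v0 v1 v2 : Fin (suc (suc (suc k)))
  v0 = zero
  v1 = suc zero
  v2 = suc (suc zero)
  es : List (Subset (suc (suc (suc k))))
  es = ∁ ⁅ v0 ⁆ ∷ ∁ ⁅ v1 ⁆ ∷ ∁ ⁅ v2 ⁆ ∷ []
  sz : ∀ i → ∣ ∁ ⁅ i ⁆ ∣ ≡ suc (suc k)
  sz i = trans (∣∁p∣≡n∸∣p∣ ⁅ i ⁆) (cong (λ x → suc (suc (suc k)) ∸ x) (∣⁅x⁆∣≡1 i))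
  unif : All (λ e → ∣ e ∣ ≡ suc (suc k)) es
  unif = sz v0 ∷ sz v1 ∷ sz v2 ∷ []
  dist : Unique es
  dist = ((λ ()) ∷ (λ ()) ∷ []) ∷ ((λ ()) ∷ []) ∷ [] ∷ []

𝓗 : (k : ℕ) → RGraph (suc (suc k)) (suc (suc (suc k)))
𝓗 = triangle

spans : ∀ {r n} → RGraph r n → Subset n → ℕ
spans G S = length (filter (λ e → e ⊆? S) (edges G))

degreeOf : ∀ {r n} → RGraph r n → Subset n → ℕ
degreeOf G T = length (filter (λ e → T ⊆? e) (edges G))

IsDesign : (t n k λ' : ℕ) → RGraph k n → Set
IsDesign t n k λ' G = (T : Subset n) → ∣ T ∣ ≡ t → degreeOf G T ≡ λ'

ExEq : ∀ {r m} → RGraph r m → (n e : ℕ) → Set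
ExEq {r} F n e =
  (Σ (RGraph r n) λ G → Free F G × numEdges G ≡ e)
  × ((G : RGraph r n) → Free F G → numEdges G ≤ e)

-- π(F) ≥ p / q.  Since the limit defining π(F) exists, π(F) ≥ p/q iff
-- for every ε = 1/j (j ≥ 1) we have ex(F,n) ≥ (p/q − 1/j) · C(n,r) for all
-- sufficiently large n; the latter is written without subtraction as
--   q·j·|E(G)| + q·C(n,r) ≥ p·j·C(n,r),
-- with the lower bound on ex witnessed by an F-free r-graph G on n vertices.
TuranDensityAtLeast : ∀ {r m} → RGraph r m → (p q : ℕ) → Set
TuranDensityAtLeast {r} F p q =
  (j : ℕ) → 1 ≤ j →
  Σ ℕ λ N → (n : ℕ) → N ≤ n →
    Σ (RGraph r n) λ G → Free F G ×
      (p * j * (n C r) ≤ q * j * numEdges G + q * (n C r))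

{-# OPTIONS --safe #-}
module Submission where

-- Colour an r-set of vertices of a tournament as an edge when the tournament induced on it is switching
-- isomorphic to a fixed t on r vertices (switching a vertex reverses all its arcs). If an (r+1)-set
-- contains an edge, it is t plus one new vertex x, and it contains a further edge avoiding the vertex b of
-- t exactly when replacing b by x gives a copy of t again. For suitable t no way of joining x to t admits
-- two such vertices b, so every (r+1)-set spans at most two edges. In a uniformly random tournament an
-- r-set is an edge with probability r! 2^r / (K 2^(r choose 2)), where K is the order of the group of
-- switching automorphisms of t (counting complementary sets of switched vertices as different);
-- for r = 6, 7, 8 there are such t with K = 10, 18, 2, which gives 9/64, 35/2^11, 315/2^14.
--
-- For r = 6 the edges inside the 12-vertex Paley tournament (of 𝔽₁₁ and a dominating vertex) form the
-- design. It is extremal because each 6-set of 12 points lies in six 7-sets, each spanning at most two edges.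

open import Defs
open import Algebra.Bundles using (CommutativeRing)
open import Data.Bool using (Bool; true; false; not; _∧_; _∨_; _xor_; if_then_else_)
import Data.Bool.Properties as Bool
open import Data.Bool.Properties using (xor-assoc; xor-comm; xor-same; xor-identityʳ; not-distribˡ-xor; not-involutive; xor-∧-commutativeRing)
open import Algebra.Properties.CommutativeSemigroup (CommutativeRing.+-commutativeSemigroup xor-∧-commutativeRing) using () renaming (interchange to xor-interchange)
open import Data.Fin using (Fin; zero; suc; toℕ; punchIn; punchOut)
open import Data.Fin.Permutation using (Permutation′; _⟨$⟩ʳ_; _⟨$⟩ˡ_; insert; insert-punchIn; inverseˡ; inverseʳ) renaming (id to idₚ)
open import Data.Fin.Properties using (punchIn-injective; punchInᵢ≢i; punchIn-punchOut; punchOut-injective; suc-injective; injective⇒≤; any?) renaming (_≟_ to _≟ᶠ_)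
open import Data.Fin.Subset using (Subset; ⁅_⁆; ∁; ⋃; ∣_∣; _⊆_; _-_) renaming (_∈_ to _∈ˢ_; ⊥ to ∅)
open import Data.Fin.Subset.Properties using (x∈p∪q⁻; x∈p∪q⁺; x∈⁅x⁆; x∈⁅y⁆⇒x≡y; x≢y⇒x∉⁅y⁆; ∉⊥; x∈∁p⇒x∉p; x∉p⇒x∈∁p; _∈?_; _⊆?_; p⊂q⇒∣p∣<∣q∣; p⊆q⇒∣p∣≤∣q∣; ⊆-antisym; ⊆-reflexive; x∈p⇒∣p-x∣<∣p∣; x∈p∧x≢y⇒x∈p-y)
open import Data.List using (List; []; _∷_; length; filter; map; allFin; _++_; concatMap; deduplicate; cartesianProduct; cartesianProductWith)
open import Data.List.Membership.Propositional using (_∈_; lose)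
open import Data.List.Membership.Propositional.Properties
open import Data.List.Properties using (length-map; length-++; length-tabulate; filter-none; map-cong; map-∘)
open import Data.List.Relation.Unary.All as All using (All; []; _∷_; all?)
import Data.List.Relation.Unary.All.Properties as All
open import Data.List.Relation.Unary.AllPairs using ([]; _∷_)
open import Data.List.Relation.Unary.Any as Any using (Any; here; there; satisfied)
open import Data.List.Relation.Unary.Unique.Propositional using (Unique)
import Data.List.Relation.Unary.Unique.Propositional.Properties as Uniq
open import Data.Nat using (ℕ; zero; suc; _+_; _*_; _^_; _∸_; _≤_; _<_; z≤n; s≤s; _≤?_; _≡ᵇ_; _≟_; NonZero; >-nonZero; _!)
open import Data.Nat.Combinatorics using (_C_; nCk+nC[k+1]≡[n+1]C[k+1])
open import Data.Nat.ListAction using (sum)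
open import Data.Nat.Properties hiding (suc-injective; _≟_)
open import Algebra.Properties.CommutativeSemigroup +-commutativeSemigroup using () renaming (interchange to +-interchange)
open import Algebra.Properties.CommutativeSemigroup *-commutativeSemigroup using () renaming (x∙yz≈y∙xz to *-leftComm)
open import Data.Product using (Σ; ∃; _×_; _,_; proj₁; proj₂)
import Data.Product.Properties as Product
open import Data.Sum using (_⊎_; inj₁; inj₂)
open import Data.Unit using (⊤; tt)
open import Data.Vec as Vec using (Vec; []; _∷_; here; there; lookup; tabulate; insertAt; _[_]≔_)
import Data.Vec.Properties as Vec
import Data.Vec.Relation.Unary.All as VecAll
import Data.Vec.Relation.Unary.All.Properties as VecAll
open import Function using (_∘_; id)
open import Function.Definitions using (Injective)
open import Relation.Binary using (DecidableEquality)
open import Relation.Binary.PropositionalEquality hiding ([_])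
open import Relation.Nullary using (¬_; Dec; yes; no; does; contradiction)
open import Relation.Nullary.Decidable using (_×-dec_; _⊎-dec_; ¬?; toWitness)
open import Relation.Unary using (Decidable)

private
  variable
    A B : Set
    k m n r : ℕ

-- Finite sums, averaging and counting in lists.

∑ : List A → (A → ℕ) → ℕ
∑ xs f = sum (map f xs)

∑-++ : ∀ (xs : List A) {ys} (f : A → ℕ) → ∑ (xs ++ ys) f ≡ ∑ xs f + ∑ ys f
∑-++ []       f = refl
∑-++ (x ∷ xs) f = trans (cong (f x +_) (∑-++ xs f)) (sym (+-assoc (f x) _ _))

∑-map : ∀ (g : A → B) xs (f : B → ℕ) → ∑ (map g xs) f ≡ ∑ xs (f ∘ g)
∑-map g xs f = cong sum (sym (map-∘ xs))

∑-cong : ∀ (xs : List A) {f g : A → ℕ} → f ≗ g → ∑ xs f ≡ ∑ xs g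
∑-cong xs f≗g = cong sum (map-cong f≗g xs)

∑-mono-All : ∀ {xs : List A} {f g : A → ℕ} → All (λ x → f x ≤ g x) xs → ∑ xs f ≤ ∑ xs g
∑-mono-All []        = z≤n
∑-mono-All (le ∷ les) = +-mono-≤ le (∑-mono-All les)

∑-mono : ∀ (xs : List A) {f g : A → ℕ} → (∀ x → f x ≤ g x) → ∑ xs f ≤ ∑ xs g
∑-mono xs f≤g = ∑-mono-All (All.universal f≤g xs)

∑-const : ∀ (xs : List A) c → ∑ xs (λ _ → c) ≡ length xs * c
∑-const []       c = refl
∑-const (x ∷ xs) c = cong (c +_) (∑-const xs c)

*-∑ : ∀ (xs : List A) c (f : A → ℕ) → ∑ xs (λ x → c * f x) ≡ c * ∑ xs f
*-∑ []       c f = sym (*-zeroʳ c)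
*-∑ (x ∷ xs) c f = trans (cong (c * f x +_) (*-∑ xs c f)) (sym (*-distribˡ-+ c (f x) _))

∑-+ : ∀ (xs : List A) (f g : A → ℕ) → ∑ xs (λ x → f x + g x) ≡ ∑ xs f + ∑ xs g
∑-+ []       f g = refl
∑-+ (x ∷ xs) f g = trans (cong (f x + g x +_) (∑-+ xs f g)) (+-interchange (f x) (g x) _ _)

∑-swap : ∀ (xs : List A) (ys : List B) (f : A → B → ℕ) →
         ∑ xs (λ x → ∑ ys (f x)) ≡ ∑ ys (λ y → ∑ xs (λ x → f x y))
∑-swap []       ys f = sym (trans (∑-const ys 0) (*-zeroʳ (length ys)))
∑-swap (x ∷ xs) ys f = trans (cong (∑ ys (f x) +_) (∑-swap xs ys f)) (sym (∑-+ ys (f x) _))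

∑-product : ∀ (xs : List A) (ys : List B) (f : A × B → ℕ) →
            ∑ (cartesianProduct xs ys) f ≡ ∑ xs (λ x → ∑ ys (λ y → f (x , y)))
∑-product []       ys f = refl
∑-product (x ∷ xs) ys f =
  trans (∑-++ (map (x ,_) ys) f) (cong₂ _+_ (∑-map (x ,_) ys f) (∑-product xs ys f))

⟦_⟧ : {P : Set} → Dec P → ℕ
⟦ P? ⟧ = if does P? then 1 else 0

length-filter≡∑ : {P : A → Set} (P? : Decidable P) (xs : List A) →
                  length (filter P? xs) ≡ ∑ xs (λ x → ⟦ P? x ⟧)
length-filter≡∑ P? []       = refl
length-filter≡∑ P? (x ∷ xs) with does (P? x)
... | true  = cong suc (length-filter≡∑ P? xs)
... | false = length-filter≡∑ P? xs

averaging : ∀ (xs : List A) (f : A → ℕ) c → 0 < length xs →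
            length xs * c ≤ ∑ xs f → ∃ λ x → c ≤ f x
averaging (x ∷ xs) f c _ = go x xs
  where
  go : ∀ x xs → length (x ∷ xs) * c ≤ ∑ (x ∷ xs) f → ∃ λ y → c ≤ f y
  go x []       le = x , subst₂ _≤_ (+-identityʳ c) (+-identityʳ (f x)) le
  go x (y ∷ ys) le with c ≤? f x
  ... | yes c≤fx = x , c≤fx
  ... | no  c≰fx = go y ys (+-cancelˡ-≤ c _ _ (≤-trans le (+-monoˡ-≤ _ (≰⇒≥ c≰fx))))

∈-split : ∀ {x : A} {ys} → x ∈ ys →
          ∃ λ zs → length ys ≡ suc (length zs) × (∀ {y} → y ≢ x → y ∈ ys → y ∈ zs)
∈-split {ys = _ ∷ ys} (here refl) =
  ys , refl , λ { y≢x (here y≡x) → contradiction y≡x y≢x ; _ (there y∈) → y∈ }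
∈-split {ys = y ∷ ys} (there x∈) with ∈-split x∈
... | zs , eq , f = y ∷ zs , cong suc eq , λ { _ (here e) → here e ; y≢x (there y∈) → there (f y≢x y∈) }

-- By induction: the head of `xs` is struck from `ys` by `∈-split`, and uniqueness keeps the tail of
-- `xs` inside what remains.
Unique-⊆-length : ∀ {xs ys : List A} → Unique xs → (∀ {x} → x ∈ xs → x ∈ ys) → length xs ≤ length ys
Unique-⊆-length {xs = []}     _         _   = z≤n
Unique-⊆-length {xs = x ∷ xs} (x∉ ∷ u) sub with ∈-split (sub (here refl))
... | zs , eq , f = subst (suc (length xs) ≤_) (sym eq)
                      (s≤s (Unique-⊆-length u (λ y∈ → f (λ { refl → All.lookup x∉ y∈ refl }) (sub (there y∈)))))

-- Subsets of prescribed size.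

-- The size is part of the type, and `index` reads off the increasing enumeration of the elements by
-- recursion.
data Choice : ℕ → ℕ → Set where
  done : Choice 0 0
  take : Choice n k → Choice (suc n) (suc k)
  skip : Choice n k → Choice (suc n) k

toSubset : Choice n k → Subset n
toSubset done     = []
toSubset (take S) = true ∷ toSubset S
toSubset (skip S) = false ∷ toSubset S

index : Choice n k → Fin k → Fin n
index (take S) zero    = zero
index (take S) (suc i) = suc (index S i)
index (skip S) i       = suc (index S i)

index-injective : (S : Choice n k) → ∀ {i j} → index S i ≡ index S j → i ≡ j
index-injective (take S) {zero}  {zero}  eq = refl
index-injective (take S) {suc i} {suc j} eq = cong suc (index-injective S (suc-injective eq))
index-injective (skip S) eq = index-injective S (suc-injective eq)

toSubset-injective : {S S′ : Choice n k} → toSubset S ≡ toSubset S′ → S ≡ S′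
toSubset-injective {S = done}   {done}    eq = refl
toSubset-injective {S = take S} {take S′} eq = cong take (toSubset-injective (Vec.∷-injectiveʳ eq))
toSubset-injective {S = skip S} {skip S′} eq = cong skip (toSubset-injective (Vec.∷-injectiveʳ eq))

∣toSubset∣ : (S : Choice n k) → ∣ toSubset S ∣ ≡ k
∣toSubset∣ done     = refl
∣toSubset∣ (take S) = cong suc (∣toSubset∣ S)
∣toSubset∣ (skip S) = ∣toSubset∣ S

choices : ∀ n k → List (Choice n k)
choices zero    zero    = done ∷ []
choices zero    (suc k) = []
choices (suc n) zero    = map skip (choices n zero)
choices (suc n) (suc k) = map take (choices n k) ++ map skip (choices n (suc k))

length-choices : ∀ n k → length (choices n k) ≡ n C k
length-choices zero    zero    = refl
length-choices zero    (suc k) = refl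
length-choices (suc n) zero    = trans (length-map skip (choices n zero)) (length-choices n zero)
length-choices (suc n) (suc k) = begin
  length (map take (choices n k) ++ map skip (choices n (suc k))) ≡⟨ length-++ (map take (choices n k)) ⟩
  length (map take (choices n k)) + length (map skip (choices n (suc k)))
    ≡⟨ cong₂ _+_ (trans (length-map take (choices n k)) (length-choices n k)) (trans (length-map skip (choices n (suc k))) (length-choices n (suc k))) ⟩
  n C k + n C suc k ≡⟨ nCk+nC[k+1]≡[n+1]C[k+1] n k ⟩
  suc n C suc k ∎
  where open ≡-Reasoning

choices-unique : ∀ n k → Unique (choices n k)
choices-unique zero    zero    = [] ∷ []
choices-unique zero    (suc k) = []
choices-unique (suc n) zero    = Uniq.map⁺ (λ { refl → refl }) (choices-unique n zero)
choices-unique (suc n) (suc k) =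
  Uniq.++⁺ (Uniq.map⁺ (λ { refl → refl }) (choices-unique n k))
           (Uniq.map⁺ (λ { refl → refl }) (choices-unique n (suc k)))
           (λ (∈take , ∈skip) → disjoint (∈-map⁻ take ∈take) (∈-map⁻ skip ∈skip))
  where
  disjoint : ∀ {S : Choice (suc n) (suc k)} → ∃ (λ S₁ → S₁ ∈ choices n k × S ≡ take S₁) →
             ¬ ∃ (λ S₂ → S₂ ∈ choices n (suc k) × S ≡ skip S₂)
  disjoint (_ , _ , refl) (_ , _ , ())

choices-complete : (S : Choice n k) → S ∈ choices n k
choices-complete done             = here refl
choices-complete {k = zero}  (skip S) = ∈-map⁺ skip (choices-complete S)
choices-complete             (take S) = ∈-++⁺ˡ (∈-map⁺ take (choices-complete S))
choices-complete {k = suc k} (skip S) = ∈-++⁺ʳ (map take (choices _ k)) (∈-map⁺ skip (choices-complete S))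

fromSubset : (p : Subset n) → ∃ λ (S : Choice n ∣ p ∣) → toSubset S ≡ p
fromSubset []          = done , refl
fromSubset (true ∷ p)  with fromSubset p
... | S , eq = take S , cong (true ∷_) eq
fromSubset (false ∷ p) with fromSubset p
... | S , eq = skip S , cong (false ∷_) eq

-- Bit vectors, tournaments and uniform restriction.

Vec-Bools : ∀ n → List (Vec Bool n)
Vec-Bools zero    = [] ∷ []
Vec-Bools (suc n) = cartesianProductWith _∷_ (true ∷ false ∷ []) (Vec-Bools n)

-- A tournament on suc n vertices: the arcs between vertex 0 and the others (true when directed away
-- from 0), and the tournament on the others.
Tour : ℕ → Set
Tour zero    = ⊤
Tour (suc n) = Vec Bool n × Tour n

tours : ∀ n → List (Tour n)
tours zero    = tt ∷ []
tours (suc n) = cartesianProduct (Vec-Bools n) (tours n)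

length-cartesianProductWith : ∀ {C : Set} (f : A → B → C) xs ys →
                              length (cartesianProductWith f xs ys) ≡ length xs * length ys
length-cartesianProductWith f []       ys = refl
length-cartesianProductWith f (x ∷ xs) ys =
  trans (length-++ (map (f x) ys)) (cong₂ _+_ (length-map (f x) ys) (length-cartesianProductWith f xs ys))

∑-Vec-Bools-suc : ∀ n (f : Vec Bool (suc n) → ℕ) →
  ∑ (Vec-Bools (suc n)) f ≡ ∑ (Vec-Bools n) (f ∘ (true ∷_)) + ∑ (Vec-Bools n) (f ∘ (false ∷_))
∑-Vec-Bools-suc n f = begin
  ∑ (map (true ∷_) V ++ (map (false ∷_) V ++ [])) f
    ≡⟨ ∑-++ (map (true ∷_) V) f ⟩
  ∑ (map (true ∷_) V) f + ∑ (map (false ∷_) V ++ []) f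
    ≡⟨ cong (∑ (map (true ∷_) V) f +_) (trans (∑-++ (map (false ∷_) V) f) (+-identityʳ _)) ⟩
  ∑ (map (true ∷_) V) f + ∑ (map (false ∷_) V) f
    ≡⟨ cong₂ _+_ (∑-map (true ∷_) V f) (∑-map (false ∷_) V f) ⟩
  ∑ V (f ∘ (true ∷_)) + ∑ V (f ∘ (false ∷_)) ∎
  where
  open ≡-Reasoning
  V = Vec-Bools n

length-Vec-Bools : ∀ n → length (Vec-Bools n) ≡ 2 ^ n
length-Vec-Bools zero    = refl
length-Vec-Bools (suc n) = trans (length-cartesianProductWith _∷_ (true ∷ false ∷ []) (Vec-Bools n))
                                 (cong (2 *_) (length-Vec-Bools n))

Bools-complete : ∀ b → b ∈ true ∷ false ∷ []
Bools-complete true  = here refl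
Bools-complete false = there (here refl)

Vec-Bools-complete : (v : Vec Bool n) → v ∈ Vec-Bools n
Vec-Bools-complete []      = here refl
Vec-Bools-complete (b ∷ v) = ∈-cartesianProductWith⁺ _∷_ (Bools-complete b) (Vec-Bools-complete v)

Vec-Bools-unique : ∀ n → Unique (Vec-Bools n)
Vec-Bools-unique zero    = [] ∷ []
Vec-Bools-unique (suc n) = Uniq.cartesianProductWith⁺ _∷_ Vec.∷-injective
                             (((λ ()) ∷ []) ∷ [] ∷ []) (Vec-Bools-unique n)

tours-complete : (t : Tour n) → t ∈ tours n
tours-complete {zero}  tt      = here refl
tours-complete {suc n} (b , t) = ∈-cartesianProduct⁺ (Vec-Bools-complete b) (tours-complete t)

tourCount : ℕ → ℕ
tourCount zero    = 1
tourCount (suc n) = 2 ^ n * tourCount n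

length-tours : ∀ n → length (tours n) ≡ tourCount n
length-tours zero    = refl
length-tours (suc n) = trans (length-cartesianProductWith _,_ (Vec-Bools n) (tours n))
                             (cong₂ _*_ (length-Vec-Bools n) (length-tours n))

_≟ᵗ_ : DecidableEquality (Tour n)
_≟ᵗ_ {zero}  tt tt = yes refl
_≟ᵗ_ {suc n} = Product.≡-dec (Vec.≡-dec Bool._≟_) _≟ᵗ_

restrictVec : Choice n k → Vec A n → Vec A k
restrictVec done     []      = []
restrictVec (take S) (a ∷ v) = a ∷ restrictVec S v
restrictVec (skip S) (a ∷ v) = restrictVec S v

restrict : Choice n k → Tour n → Tour k
restrict done     tt      = tt
restrict (take S) (b , t) = restrictVec S b , restrict S t
restrict (skip S) (b , t) = restrict S t

-- All fibres of `restrictVec S` have the same size, each skipped position doubling it. The constant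
-- is chosen before `f`, so that a particular `f` can identify it later.
∑-restrictVec : (S : Choice n k) → ∃ λ c → ∀ f →
                ∑ (Vec-Bools n) (f ∘ restrictVec S) ≡ c * ∑ (Vec-Bools k) f
∑-restrictVec done = 1 , λ f → sym (*-identityˡ _)
∑-restrictVec {suc n} {suc k} (take S) with ∑-restrictVec S
... | c , eq = c , λ f → begin
  ∑ (Vec-Bools (suc n)) (f ∘ restrictVec (take S))
    ≡⟨ ∑-Vec-Bools-suc n (f ∘ restrictVec (take S)) ⟩
  ∑ (Vec-Bools n) (f ∘ (true ∷_) ∘ restrictVec S) + ∑ (Vec-Bools n) (f ∘ (false ∷_) ∘ restrictVec S)
    ≡⟨ cong₂ _+_ (eq (f ∘ (true ∷_))) (eq (f ∘ (false ∷_))) ⟩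
  c * ∑ (Vec-Bools k) (f ∘ (true ∷_)) + c * ∑ (Vec-Bools k) (f ∘ (false ∷_))
    ≡⟨ sym (*-distribˡ-+ c _ _) ⟩
  c * (∑ (Vec-Bools k) (f ∘ (true ∷_)) + ∑ (Vec-Bools k) (f ∘ (false ∷_)))
    ≡⟨ cong (c *_) (sym (∑-Vec-Bools-suc k f)) ⟩
  c * ∑ (Vec-Bools (suc k)) f ∎
  where open ≡-Reasoning
∑-restrictVec {suc n} (skip S) with ∑-restrictVec S
... | c , eq = c + c , λ f →
  trans (∑-Vec-Bools-suc n (f ∘ restrictVec (skip S)))
        (trans (cong₂ _+_ (eq f) (eq f)) (sym (*-distribʳ-+ _ c c)))

-- The restriction of a uniformly random tournament is uniformly random.
∑-restrict : (S : Choice n k) → ∃ λ c → ∀ f → ∑ (tours n) (f ∘ restrict S) ≡ c * ∑ (tours k) f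
∑-restrict done = 1 , λ f → sym (*-identityˡ _)
∑-restrict {suc n} {suc k} (take S) with ∑-restrictVec S | ∑-restrict S
... | c , eq | d , eq′ = d * c , λ f → begin
  ∑ (tours (suc n)) (f ∘ restrict (take S))
    ≡⟨ ∑-product (Vec-Bools n) (tours n) _ ⟩
  ∑ (Vec-Bools n) (λ b → ∑ (tours n) (λ t → f (restrictVec S b , restrict S t)))
    ≡⟨ ∑-cong (Vec-Bools n) (λ b → eq′ (λ u → f (restrictVec S b , u))) ⟩
  ∑ (Vec-Bools n) (λ b → d * ∑ (tours k) (λ u → f (restrictVec S b , u)))
    ≡⟨ *-∑ (Vec-Bools n) d _ ⟩
  d * ∑ (Vec-Bools n) (λ b → ∑ (tours k) (λ u → f (restrictVec S b , u)))
    ≡⟨ cong (d *_) (eq (λ a → ∑ (tours k) (λ u → f (a , u)))) ⟩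
  d * (c * ∑ (Vec-Bools k) (λ a → ∑ (tours k) (λ u → f (a , u))))
    ≡⟨ sym (*-assoc d c _) ⟩
  d * c * ∑ (Vec-Bools k) (λ a → ∑ (tours k) (λ u → f (a , u)))
    ≡⟨ cong (d * c *_) (sym (∑-product (Vec-Bools k) (tours k) f)) ⟩
  d * c * ∑ (tours (suc k)) f ∎
  where open ≡-Reasoning
∑-restrict {suc n} {k} (skip S) with ∑-restrict S
... | d , eq′ = length (Vec-Bools n) * d , λ f → begin
  ∑ (tours (suc n)) (f ∘ restrict (skip S))
    ≡⟨ ∑-product (Vec-Bools n) (tours n) _ ⟩
  ∑ (Vec-Bools n) (λ _ → ∑ (tours n) (f ∘ restrict S))
    ≡⟨ ∑-const (Vec-Bools n) _ ⟩
  length (Vec-Bools n) * ∑ (tours n) (f ∘ restrict S)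
    ≡⟨ cong (length (Vec-Bools n) *_) (eq′ f) ⟩
  length (Vec-Bools n) * (d * ∑ (tours k) f)
    ≡⟨ sym (*-assoc (length (Vec-Bools n)) d _) ⟩
  length (Vec-Bools n) * d * ∑ (tours k) f ∎
  where open ≡-Reasoning

-- Tournaments as skew Boolean matrices.

Matrix : ℕ → Set
Matrix n = Fin n → Fin n → Bool

Skew : Matrix n → Set
Skew s = ∀ {i j} → i ≢ j → s j i ≡ not (s i j)

arc : Tour n → Matrix n
-- The diagonal value is a convention; `Skew` speaks of distinct vertices only.
arc {suc n} (b , t) zero    zero    = false
arc {suc n} (b , t) zero    (suc j) = lookup b j
arc {suc n} (b , t) (suc i) zero    = not (lookup b i)
arc {suc n} (b , t) (suc i) (suc j) = arc t i j

arc-skew : (t : Tour n) → Skew (arc t)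
arc-skew {suc n} (b , t) {zero}  {zero}  0≢0 = contradiction refl 0≢0
arc-skew {suc n} (b , t) {zero}  {suc j} _   = refl
arc-skew {suc n} (b , t) {suc i} {zero}  _   = sym (not-involutive _)
arc-skew {suc n} (b , t) {suc i} {suc j} i≢j = arc-skew t (i≢j ∘ cong suc)

lookup-restrictVec : (S : Choice n k) (v : Vec A n) (i : Fin k) →
                     lookup (restrictVec S v) i ≡ lookup v (index S i)
lookup-restrictVec (take S) (a ∷ v) zero    = refl
lookup-restrictVec (take S) (a ∷ v) (suc i) = lookup-restrictVec S v i
lookup-restrictVec (skip S) (a ∷ v) i       = lookup-restrictVec S v i

arc-restrict : (S : Choice n k) (t : Tour n) (i j : Fin k) →
               arc (restrict S t) i j ≡ arc t (index S i) (index S j)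
arc-restrict (take S) (b , t) zero    zero    = refl
arc-restrict (take S) (b , t) zero    (suc j) = lookup-restrictVec S b j
arc-restrict (take S) (b , t) (suc i) zero    = cong not (lookup-restrictVec S b i)
arc-restrict (take S) (b , t) (suc i) (suc j) = arc-restrict S t i j
arc-restrict (skip S) (b , t) i       j       = arc-restrict S t i j

fromMatrix : Matrix n → Tour n
fromMatrix {zero}  s = tt
fromMatrix {suc n} s = tabulate (λ j → s zero (suc j)) , fromMatrix (λ i j → s (suc i) (suc j))

arc-fromMatrix : {s : Matrix n} → Skew s → ∀ {i j} → i ≢ j → arc (fromMatrix s) i j ≡ s i j
arc-fromMatrix {suc n} sk {zero}  {zero}  0≢0 = contradiction refl 0≢0
arc-fromMatrix {suc n} sk {zero}  {suc j} _   = Vec.lookup∘tabulate _ j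
arc-fromMatrix {suc n} sk {suc i} {zero}  _   =
  trans (cong not (Vec.lookup∘tabulate _ i)) (sym (sk (λ ())))
arc-fromMatrix {suc n} sk {suc i} {suc j} i≢j =
  arc-fromMatrix (λ i≢j → sk (i≢j ∘ suc-injective)) (i≢j ∘ cong suc)

-- Permutations, switchings and their action on tournaments.

-- Lehmer codes.
Code : ℕ → Set
Code zero    = ⊤
Code (suc n) = Fin (suc n) × Code n

codes : ∀ n → List (Code n)
codes zero    = tt ∷ []
codes (suc n) = cartesianProduct (allFin (suc n)) (codes n)

length-codes : ∀ n → length (codes n) ≡ n !
length-codes zero    = refl
length-codes (suc n) = trans (length-cartesianProductWith _,_ (allFin (suc n)) (codes n))
                             (cong₂ _*_ (length-tabulate {n = suc n} id) (length-codes n))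

codes-unique : ∀ n → Unique (codes n)
codes-unique zero    = [] ∷ []
codes-unique (suc n) = Uniq.cartesianProduct⁺ (Uniq.allFin⁺ (suc n)) (codes-unique n)

decode : Code n → Permutation′ n
decode {zero}  tt      = idₚ
decode {suc n} (x , c) = insert zero x (decode c)

-- The image of `zero` is the leading digit; undoing its `punchIn` reduces the other images to the
-- remaining digits.
decode-injective : (c d : Code n) → (∀ i → decode c ⟨$⟩ʳ i ≡ decode d ⟨$⟩ʳ i) → c ≡ d
decode-injective {zero}  tt      tt      eq = refl
decode-injective {suc n} (x , c) (y , d) eq with eq zero
... | refl = cong (x ,_) (decode-injective c d λ i → punchIn-injective x _ _
  (trans (sym (insert-punchIn zero x (decode c) i))
         (trans (eq (suc i)) (insert-punchIn zero x (decode d) i))))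

Labelling : ℕ → Set
Labelling r = Code r × Vec Bool r

labellings : ∀ r → List (Labelling r)
labellings r = cartesianProduct (codes r) (Vec-Bools r)

length-labellings : ∀ r → length (labellings r) ≡ r ! * 2 ^ r
length-labellings r = trans (length-cartesianProductWith _,_ (codes r) (Vec-Bools r))
                            (cong₂ _*_ (length-codes r) (length-Vec-Bools r))

labellings-unique : ∀ r → Unique (labellings r)
labellings-unique r = Uniq.cartesianProduct⁺ (codes-unique r) (Vec-Bools-unique r)

-- A labelling permutes the vertices and switches those with bit true.
relabelMatrix : Tour r → Labelling r → Matrix r
relabelMatrix t (c , ε) i j =
  arc t (decode c ⟨$⟩ʳ i) (decode c ⟨$⟩ʳ j) xor (lookup ε i xor lookup ε j)

permutation-injective : (π : Permutation′ n) → ∀ {i j} → π ⟨$⟩ʳ i ≡ π ⟨$⟩ʳ j → i ≡ j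
permutation-injective π eq = trans (sym (inverseˡ π)) (trans (cong (π ⟨$⟩ˡ_) eq) (inverseˡ π))

relabelMatrix-skew : (t : Tour r) (x : Labelling r) → Skew (relabelMatrix t x)
relabelMatrix-skew t (c , ε) {i} {j} i≢j = begin
  arc t πj πi xor (lookup ε j xor lookup ε i)     ≡⟨ cong₂ _xor_ (arc-skew t (i≢j ∘ permutation-injective (decode c))) (xor-comm (lookup ε j) (lookup ε i)) ⟩
  not (arc t πi πj) xor (lookup ε i xor lookup ε j) ≡⟨ sym (not-distribˡ-xor (arc t πi πj) _) ⟩
  not (arc t πi πj xor (lookup ε i xor lookup ε j)) ∎
  where
  open ≡-Reasoning
  πi = decode c ⟨$⟩ʳ i
  πj = decode c ⟨$⟩ʳ j

relabel : Tour r → Labelling r → Tour r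
relabel t x = fromMatrix (relabelMatrix t x)

-- Enumeration of switching embeddings.

-- A partial switching isomorphism into s is a vector giving each vertex its image and its switching bit.
row : Matrix m → Fin m × Bool → Vec (Fin m × Bool) k → Vec Bool k
row s (x , e) = Vec.map (λ (y , d) → s x y xor (e xor d))

Fresh : Fin m → Vec (Fin m × Bool) k → Set
Fresh x = VecAll.All (λ (y , _) → x ≢ y)

fresh? : (x : Fin m) (v : Vec (Fin m × Bool) k) → Dec (Fresh x v)
fresh? x = VecAll.all? (λ (y , _) → ¬? (x ≟ᶠ y))

IsEmbedding : Matrix m → Tour k → Vec (Fin m × Bool) k → Set
IsEmbedding s tt      []            = ⊤
IsEmbedding s (b , t) ((x , e) ∷ v) = (Fresh x v × row s (x , e) v ≡ b) × IsEmbedding s t v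

signedPoints : ∀ m → List (Fin m × Bool)
signedPoints m = cartesianProduct (allFin m) (true ∷ false ∷ [])

signedPoints-complete : (p : Fin m × Bool) → p ∈ signedPoints m
signedPoints-complete (x , e) = ∈-cartesianProduct⁺ (∈-allFin x) (Bools-complete e)

-- Shared by `embeddings`, which goes on to filter by the arcs at the new point, and
-- `replacementsAt`, which records those arcs.
extensions : Matrix m → List (Vec (Fin m × Bool) k) → List (Vec (Fin m × Bool) k × Fin m × Bool)
extensions {m} s vs = filter (λ (v , x , _) → fresh? x v) (cartesianProduct vs (signedPoints m))

extensions-complete : ∀ (s : Matrix m) {vs : List (Vec (Fin m × Bool) k)} {v} p →
                      v ∈ vs → Fresh (proj₁ p) v → (v , p) ∈ extensions s vs
extensions-complete s {vs} p v∈ fr =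
  ∈-filter⁺ (λ (v , x , _) → fresh? x v) {xs = cartesianProduct vs (signedPoints _)}
            (∈-cartesianProduct⁺ v∈ (signedPoints-complete p)) fr

-- Backtracking from the last vertex to the first: a partial map whose new row disagrees with the
-- tournament is discarded at once, which keeps the list small enough to evaluate.
embeddings : Matrix m → Tour k → List (Vec (Fin m × Bool) k)
embeddings {k = zero}  s tt      = [] ∷ []
embeddings {k = suc k} s (b , t) =
  map (λ (v , p) → p ∷ v)
      (filter (λ (v , p) → Vec.≡-dec Bool._≟_ (row s p v) b) (extensions s (embeddings s t)))

-- Completeness is the direction that matters: the length of the list serves as an upper bound, and
-- its members undergo a universal check.
embeddings-complete : ∀ (s : Matrix m) (t : Tour k) {v} → IsEmbedding s t v → v ∈ embeddings s t
embeddings-complete s tt      {[]}    _             = here refl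
embeddings-complete s (b , t) {p ∷ v} ((fr , eq) , emb) =
  ∈-map⁺ _ (∈-filter⁺ _ (extensions-complete s p (embeddings-complete s t emb) fr) eq)

tabulate-isEmbedding : ∀ (s : Matrix m) (t : Tour k) (η : Fin k → Fin m) (d : Fin k → Bool) →
  Injective _≡_ _≡_ η →
  (∀ {i j} → i ≢ j → s (η i) (η j) xor (d i xor d j) ≡ arc t i j) →
  IsEmbedding s t (tabulate (λ i → η i , d i))
tabulate-isEmbedding {k = zero}  s tt      η d inj eq = tt
tabulate-isEmbedding {k = suc k} s (b , t) η d inj eq =
  ( VecAll.tabulate⁺ (λ i 0≡ → zero≢suc (inj 0≡))
  , trans (sym (Vec.tabulate-∘ _ _)) (trans (Vec.tabulate-cong (λ j → eq {zero} {suc j} (λ ()))) (Vec.tabulate∘lookup b)) )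
  , tabulate-isEmbedding s t (η ∘ suc) (d ∘ suc) (suc-injective ∘ inj) (λ i≢j → eq (i≢j ∘ suc-injective))
  where
  zero≢suc : ∀ {i : Fin k} → zero ≢ Fin.suc i
  zero≢suc ()

-- Size of a switching isomorphism class.

SwitchingIsomorphic : Tour r → Tour r → Set
SwitchingIsomorphic t u = Any (λ x → relabel t x ≡ u) (labellings _)

switchingIsomorphic? : (t u : Tour r) → Dec (SwitchingIsomorphic t u)
switchingIsomorphic? t u = Any.any? (λ x → relabel t x ≟ᵗ u) (labellings _)

-- Arithmetic in 𝔽₂: if one arc is read as x through the switching bits a, b and as y through c, d,
-- then passing from y to x switches by a + c and b + d.
xor-transfer : ∀ x y a b c d → x xor (a xor b) ≡ y xor (c xor d) → y xor ((a xor c) xor (b xor d)) ≡ x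
xor-transfer x y a b c d eq = begin
  y xor ((a xor c) xor (b xor d)) ≡⟨ cong (y xor_) (xor-interchange a c b d) ⟩
  y xor ((a xor b) xor (c xor d)) ≡⟨ cong (y xor_) (xor-comm (a xor b) _) ⟩
  y xor ((c xor d) xor (a xor b)) ≡⟨ sym (xor-assoc y _ _) ⟩
  (y xor (c xor d)) xor (a xor b) ≡⟨ cong (_xor (a xor b)) (sym eq) ⟩
  (x xor (a xor b)) xor (a xor b) ≡⟨ xor-assoc x _ _ ⟩
  x xor ((a xor b) xor (a xor b)) ≡⟨ cong (x xor_) (xor-same (a xor b)) ⟩
  x xor false                     ≡⟨ xor-identityʳ x ⟩
  x                               ∎
  where open ≡-Reasoning

relabel-arc : ∀ (t : Tour r) c ε {u i j} → relabel t (c , ε) ≡ u → i ≢ j →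
              arc u i j ≡ arc t (decode c ⟨$⟩ʳ i) (decode c ⟨$⟩ʳ j) xor (lookup ε i xor lookup ε j)
relabel-arc t c ε refl i≢j = arc-fromMatrix (relabelMatrix-skew t (c , ε)) i≢j

-- Two labellings of the same tournament differ by a switching automorphism.
transition : Labelling r → Labelling r → Vec (Fin r × Bool) r
transition (c₀ , ε₀) (c , ε) =
  tabulate (λ a → decode c ⟨$⟩ʳ (decode c₀ ⟨$⟩ˡ a)
                , lookup ε₀ (decode c₀ ⟨$⟩ˡ a) xor lookup ε (decode c₀ ⟨$⟩ˡ a))

transition-isEmbedding : ∀ (t : Tour r) {u} (x₀ x : Labelling r) → relabel t x₀ ≡ u → relabel t x ≡ u →
                         IsEmbedding (arc t) t (transition x₀ x)
transition-isEmbedding t (c₀ , ε₀) (c , ε) eq₀ eq =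
  tabulate-isEmbedding (arc t) t _ _
    (λ e → ˡ-injective (permutation-injective (decode c) e))
    (λ {a} {b} a≢b →
      let a′≢b′ = a≢b ∘ ˡ-injective in
      trans (xor-transfer _ (arc t (decode c ⟨$⟩ʳ π₀⁻¹ a) (decode c ⟨$⟩ʳ π₀⁻¹ b))
                            (lookup ε₀ (π₀⁻¹ a)) (lookup ε₀ (π₀⁻¹ b)) (lookup ε (π₀⁻¹ a)) (lookup ε (π₀⁻¹ b))
              (trans (sym (relabel-arc t c₀ ε₀ eq₀ a′≢b′)) (relabel-arc t c ε eq a′≢b′)))
            (cong₂ (arc t) (inverseʳ (decode c₀)) (inverseʳ (decode c₀))))
  where
  π₀   = decode c₀ ⟨$⟩ʳ_
  π₀⁻¹ = decode c₀ ⟨$⟩ˡ_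
  ˡ-injective : ∀ {a b} → π₀⁻¹ a ≡ π₀⁻¹ b → a ≡ b
  ˡ-injective e = trans (sym (inverseʳ (decode c₀))) (trans (cong π₀ e) (inverseʳ (decode c₀)))

xor-cancelˡ : ∀ a {b c} → a xor b ≡ a xor c → b ≡ c
xor-cancelˡ false eq = eq
xor-cancelˡ true  eq = Bool.not-injective eq

-- Composition with the inverse of the fixed `x₀` can be undone: evaluation at the image of i under
-- the permutation of `x₀` recovers the permutation, and cancelling `ε₀` recovers the bits.
transition-injective : ∀ (x₀ : Labelling r) {x y} → transition x₀ x ≡ transition x₀ y → x ≡ y
transition-injective (c₀ , ε₀) {c , ε} {d , δ} eq =
  cong₂ _,_ (decode-injective c d (proj₁ ∘ pointwise))
            (trans (sym (Vec.tabulate∘lookup ε))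
                   (trans (Vec.tabulate-cong (λ i → xor-cancelˡ (lookup ε₀ i) (proj₂ (pointwise i))))
                          (Vec.tabulate∘lookup δ)))
  where
  pointwise : ∀ i → (decode c ⟨$⟩ʳ i ≡ decode d ⟨$⟩ʳ i)
                  × (lookup ε₀ i xor lookup ε i ≡ lookup ε₀ i xor lookup δ i)
  pointwise i = Product.,-injective (subst
    (λ j → (decode c ⟨$⟩ʳ j , lookup ε₀ j xor lookup ε j) ≡ (decode d ⟨$⟩ʳ j , lookup ε₀ j xor lookup δ j))
    (inverseˡ (decode c₀))
    (trans (sym (Vec.lookup∘tabulate _ (decode c₀ ⟨$⟩ʳ i)))
           (trans (cong (λ v → lookup v (decode c₀ ⟨$⟩ʳ i)) eq) (Vec.lookup∘tabulate _ (decode c₀ ⟨$⟩ʳ i)))))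

-- Once a member `x₀` of the fibre is fixed, `transition x₀` injects the fibre into the switching
-- automorphisms of `t`. An empty fibre matches a zero bracket.
fibre-bound : ∀ (t u : Tour r) → length (filter (λ x → relabel t x ≟ᵗ u) (labellings r))
                               ≤ length (embeddings (arc t) t) * ⟦ switchingIsomorphic? t u ⟧
fibre-bound {r} t u with switchingIsomorphic? t u
... | no ¬iso = subst (_≤ _) (sym (cong length (filter-none _ (All.¬Any⇒All¬ (labellings r) ¬iso)))) z≤n
... | yes iso = subst₂ _≤_ (length-map (transition x₀) F) (sym (*-identityʳ _))
                  (Unique-⊆-length (Uniq.map⁺ (transition-injective x₀) (Uniq.filter⁺ _ (labellings-unique r))) sub)
  where
  F  = filter (λ x → relabel t x ≟ᵗ u) (labellings r)
  x₀ = proj₁ (satisfied iso)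
  sub : ∀ {v} → v ∈ map (transition x₀) F → v ∈ embeddings (arc t) t
  sub v∈ with ∈-map⁻ (transition x₀) v∈
  ... | x , x∈F , refl = embeddings-complete (arc t) t
        (transition-isEmbedding t x₀ x (proj₂ (satisfied iso)) (proj₂ (∈-filter⁻ (λ x → relabel t x ≟ᵗ u) {xs = labellings r} x∈F)))

∈⇒1≤∑ : ∀ {P : A → Set} (P? : Decidable P) {x xs} → x ∈ xs → P x → 1 ≤ ∑ xs (λ y → ⟦ P? y ⟧)
∈⇒1≤∑ P? {xs = xs} x∈ px = subst (1 ≤_) (length-filter≡∑ P? xs) (∈-length (∈-filter⁺ P? x∈ px))

isomorphs : Tour r → ℕ
isomorphs t = ∑ (tours _) (λ u → ⟦ switchingIsomorphic? t u ⟧)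

-- The inequality half of the orbit-stabiliser theorem: the r! 2^r labellings are distributed over
-- the class of `t`, at most K to each tournament.
orbit-bound : ∀ (t : Tour r) → r ! * 2 ^ r ≤ length (embeddings (arc t) t) * isomorphs t
orbit-bound {r} t = begin
  r ! * 2 ^ r                                       ≡⟨ sym (length-labellings r) ⟩
  length (labellings r)                             ≡⟨ sym (*-identityʳ _) ⟩
  length (labellings r) * 1                         ≡⟨ sym (∑-const (labellings r) 1) ⟩
  ∑ (labellings r) (λ _ → 1)                        ≤⟨ ∑-mono (labellings r) (λ x → ∈⇒1≤∑ (relabel t x ≟ᵗ_) (tours-complete (relabel t x)) refl) ⟩
  ∑ (labellings r) (λ x → ∑ (tours r) (λ u → ⟦ relabel t x ≟ᵗ u ⟧)) ≡⟨ ∑-swap (labellings r) (tours r) _ ⟩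
  ∑ (tours r) (λ u → ∑ (labellings r) (λ x → ⟦ relabel t x ≟ᵗ u ⟧))
    ≡⟨ ∑-cong (tours r) (λ u → sym (length-filter≡∑ (λ x → relabel t x ≟ᵗ u) (labellings r))) ⟩
  ∑ (tours r) (λ u → length (filter (λ x → relabel t x ≟ᵗ u) (labellings r)))
    ≤⟨ ∑-mono (tours r) (fibre-bound t) ⟩
  ∑ (tours r) (λ u → K * ⟦ switchingIsomorphic? t u ⟧) ≡⟨ *-∑ (tours r) K _ ⟩
  K * isomorphs t ∎
  where
  open ≤-Reasoning
  K = length (embeddings (arc t) t)

-- In fractions: p/q is at most r! 2^r / (K `tourCount r`), which by `orbit-bound` is at most the
-- proportion of tournaments switching isomorphic to `t`.
isomorphs-bound : ∀ (t : Tour r) {K} .{{_ : NonZero K}} p q → length (embeddings (arc t) t) ≡ K →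
                  p * K * tourCount r ≤ q * (r ! * 2 ^ r) →
                  p * tourCount r ≤ q * isomorphs t
isomorphs-bound {r} t {K} p q refl le = *-cancelˡ-≤ K (begin
  K * (p * tourCount r)   ≡⟨ sym (*-assoc K p _) ⟩
  K * p * tourCount r     ≡⟨ cong (_* tourCount r) (*-comm K p) ⟩
  p * K * tourCount r     ≤⟨ le ⟩
  q * (r ! * 2 ^ r)       ≤⟨ *-monoʳ-≤ q (orbit-bound t) ⟩
  q * (K * isomorphs t)   ≡⟨ *-leftComm q K _ ⟩
  K * (q * isomorphs t)   ∎)
  where
  open ≤-Reasoning

-- The hypergraph of copies in a random tournament.

hypergraph : ∀ {P : Choice n k → Set} → Decidable P → RGraph k n
hypergraph {n} {k} P? = record
  { edges    = map toSubset (filter P? (choices n k))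
  ; distinct = Uniq.map⁺ toSubset-injective (Uniq.filter⁺ P? (choices-unique n k))
  ; uniform  = All.map⁺ (All.universal ∣toSubset∣ (filter P? (choices n k)))
  }

numEdges-hypergraph : ∀ {P : Choice n k → Set} (P? : Decidable P) →
                      numEdges (hypergraph P?) ≡ ∑ (choices n k) (λ S → ⟦ P? S ⟧)
numEdges-hypergraph {n} {k} P? = trans (length-map toSubset (filter P? (choices n k))) (length-filter≡∑ P? (choices n k))

copyGraph : Tour r → Tour n → RGraph r n
copyGraph t T = hypergraph (λ S → switchingIsomorphic? t (restrict S T))

-- Linearity of expectation: after exchanging the two sums, every r-set is an edge with the same
-- probability because restriction is uniform.
copyGraph-average : ∀ (t : Tour r) n → length (tours n) * ((n C r) * isomorphs t)
                    ≡ length (tours r) * ∑ (tours n) (λ T → numEdges (copyGraph t T))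
copyGraph-average {r} t n = sym (begin
  length (tours r) * ∑ (tours n) (λ T → numEdges (copyGraph t T))
    ≡⟨ cong (length (tours r) *_) (∑-cong (tours n) (λ T → numEdges-hypergraph (λ S → switchingIsomorphic? t (restrict S T)))) ⟩
  length (tours r) * ∑ (tours n) (λ T → ∑ (choices n r) (λ S → iso (restrict S T)))
    ≡⟨ cong (length (tours r) *_) (∑-swap (tours n) (choices n r) _) ⟩
  length (tours r) * ∑ (choices n r) (λ S → ∑ (tours n) (iso ∘ restrict S))
    ≡⟨ sym (*-∑ (choices n r) (length (tours r)) _) ⟩
  ∑ (choices n r) (λ S → length (tours r) * ∑ (tours n) (iso ∘ restrict S))
    ≡⟨ ∑-cong (choices n r) each ⟩
  ∑ (choices n r) (λ _ → length (tours n) * isomorphs t)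
    ≡⟨ ∑-const (choices n r) _ ⟩
  length (choices n r) * (length (tours n) * isomorphs t)
    ≡⟨ cong (_* (length (tours n) * isomorphs t)) (length-choices n r) ⟩
  (n C r) * (length (tours n) * isomorphs t)
    ≡⟨ *-leftComm (n C r) (length (tours n)) _ ⟩
  length (tours n) * ((n C r) * isomorphs t) ∎)
  where
  open ≡-Reasoning
  iso : Tour r → ℕ
  iso u = ⟦ switchingIsomorphic? t u ⟧
  each : ∀ S → length (tours r) * ∑ (tours n) (iso ∘ restrict S) ≡ length (tours n) * isomorphs t
  each S with ∑-restrict S
  ... | c , eq = begin
    length (tours r) * ∑ (tours n) (iso ∘ restrict S) ≡⟨ cong (length (tours r) *_) (eq iso) ⟩
    length (tours r) * (c * isomorphs t)              ≡⟨ *-leftComm (length (tours r)) c _ ⟩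
    c * (length (tours r) * isomorphs t)              ≡⟨ sym (*-assoc c _ _) ⟩
    c * length (tours r) * isomorphs t                ≡⟨ cong (_* isomorphs t) total ⟩
    length (tours n) * isomorphs t                    ∎
    where
    -- The constant function 1 reveals `c` as the ratio of the numbers of tournaments.
    total : c * length (tours r) ≡ length (tours n)
    total = sym (trans (sym (trans (∑-const (tours n) 1) (*-identityʳ _)))
                       (trans (eq (λ _ → 1)) (cong (c *_) (trans (∑-const (tours r) 1) (*-identityʳ _)))))

0<tourCount : ∀ r → 0 < tourCount r
0<tourCount r = subst (0 <_) (length-tours r) (∈-length (tours-complete {r} (fromMatrix (λ _ _ → false))))

-- First moment method: some tournament has at least the average number of copies. The factor `L` is
-- carried through the averaging and cancelled at the end.
copyGraph-dense : ∀ (t : Tour r) p q → p * tourCount r ≤ q * isomorphs t →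
                  ∀ n → ∃ λ T → p * (n C r) ≤ q * numEdges (copyGraph {n = n} t T)
copyGraph-dense {r} t p q le n with averaging (tours n) (λ T → L * (q * numEdges (copyGraph t T))) (L * (p * (n C r)))
                                     (subst (0 <_) (sym (length-tours n)) (0<tourCount n)) total
  where
  L = tourCount r
  open ≤-Reasoning
  total : length (tours n) * (L * (p * (n C r))) ≤ ∑ (tours n) (λ T → L * (q * numEdges (copyGraph t T)))
  total = begin
    length (tours n) * (L * (p * (n C r)))       ≡⟨ cong (length (tours n) *_) (trans (sym (*-assoc L p _)) (cong (_* (n C r)) (*-comm L p))) ⟩
    length (tours n) * (p * L * (n C r))         ≤⟨ *-monoʳ-≤ (length (tours n)) (*-monoˡ-≤ (n C r) le) ⟩
    length (tours n) * (q * isomorphs t * (n C r)) ≡⟨ cong (length (tours n) *_) (trans (*-assoc q _ _) (cong (q *_) (*-comm (isomorphs t) _))) ⟩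
    length (tours n) * (q * ((n C r) * isomorphs t)) ≡⟨ *-leftComm (length (tours n)) q _ ⟩
    q * (length (tours n) * ((n C r) * isomorphs t)) ≡⟨ cong (q *_) (copyGraph-average t n) ⟩
    q * (length (tours r) * ∑ (tours n) (λ T → numEdges (copyGraph t T))) ≡⟨ *-leftComm q (length (tours r)) _ ⟩
    length (tours r) * (q * ∑ (tours n) (λ T → numEdges (copyGraph t T))) ≡⟨ cong₂ _*_ (length-tours r) (sym (*-∑ (tours n) q _)) ⟩
    L * ∑ (tours n) (λ T → q * numEdges (copyGraph t T)) ≡⟨ sym (*-∑ (tours n) L _) ⟩
    ∑ (tours n) (λ T → L * (q * numEdges (copyGraph t T))) ∎
... | T , le′ = T , *-cancelˡ-≤ (tourCount r) {{>-nonZero (0<tourCount r)}} le′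

-- Edges inside a set with one more vertex.

∈-⋃⁻ : ∀ {x : Fin n} ps → x ∈ˢ ⋃ ps → ∃ λ p → p ∈ ps × x ∈ˢ p
∈-⋃⁻ []       x∈ = contradiction x∈ ∉⊥
∈-⋃⁻ (p ∷ ps) x∈ with x∈p∪q⁻ p (⋃ ps) x∈
... | inj₁ x∈p = p , here refl , x∈p
... | inj₂ x∈⋃ with ∈-⋃⁻ ps x∈⋃
...   | q , q∈ , x∈q = q , there q∈ , x∈q

∈-⋃⁺ : ∀ {x : Fin n} {p ps} → p ∈ ps → x ∈ˢ p → x ∈ˢ ⋃ ps
∈-⋃⁺ (here refl) x∈p = x∈p∪q⁺ (inj₁ x∈p)
∈-⋃⁺ (there p∈)  x∈p = x∈p∪q⁺ (inj₂ (∈-⋃⁺ p∈ x∈p))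

∈-image⁻ : ∀ (f : Fin m → Fin n) e {x} → x ∈ˢ image f e → ∃ λ i → i ∈ˢ e × x ≡ f i
∈-image⁻ {m} f e x∈ with ∈-⋃⁻ (map (λ i → if lookup e i then ⁅ f i ⁆ else ∅) (allFin m)) x∈
... | p , p∈ , x∈p with ∈-map⁻ _ p∈
...   | i , _ , refl with lookup e i in eq
...     | true  = i , Vec.lookup⇒[]= i e eq , x∈⁅y⁆⇒x≡y (f i) x∈p
...     | false = contradiction x∈p ∉⊥

∈-image⁺ : ∀ (f : Fin m → Fin n) e {i} → i ∈ˢ e → f i ∈ˢ image f e
∈-image⁺ {m} f e {i} i∈e = ∈-⋃⁺ (∈-map⁺ _ (∈-allFin i))
  (subst (λ b → f i ∈ˢ (if b then ⁅ f i ⁆ else ∅)) (sym (Vec.[]=⇒lookup i∈e)) (x∈⁅x⁆ (f i)))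

index-∈ˢ : (S : Choice n k) (i : Fin k) → index S i ∈ˢ toSubset S
index-∈ˢ (take S) zero    = here
index-∈ˢ (take S) (suc i) = there (index-∈ˢ S i)
index-∈ˢ (skip S) i       = there (index-∈ˢ S i)

-- A missed value could be punched out of the codomain, leaving an injection into a smaller set.
injective⇒surjective : ∀ {f : Fin n → Fin n} → Injective _≡_ _≡_ f → ∀ y → ∃ λ x → f x ≡ y
injective⇒surjective {suc n} {f} inj y with any? (λ x → f x ≟ᶠ y)
... | yes hit = hit
... | no miss = contradiction (injective⇒≤ {f = λ x → punchOut (y≢f x)} (inj ∘ punchOut-injective (y≢f _) (y≢f _))) 1+n≰n
  where
  y≢f : ∀ x → y ≢ f x
  y≢f x eq = miss (x , sym eq)

-- An edge inside an (r+1)-set, indexed by the vertex `v` it omits; `sign` holds the switching bits.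
record Copy (t : Tour r) (s : Matrix (suc r)) (v : Fin (suc r)) : Set where
  field
    vertex    : Fin r → Fin (suc r)
    sign      : Fin r → Bool
    injective : Injective _≡_ _≡_ vertex
    avoids    : ∀ i → v ≢ vertex i
    arcs      : ∀ {i j} → i ≢ j → s (vertex i) (vertex j) ≡ arc t i j xor (sign i xor sign j)

  onto : ∀ {x} → v ≢ x → ∃ λ i → vertex i ≡ x
  onto v≢x with injective⇒surjective {f = λ i → punchOut (avoids i)}
                  (injective ∘ punchOut-injective (avoids _) (avoids _)) (punchOut v≢x)
  ... | i , eq = i , punchOut-injective (avoids i) v≢x eq

-- The edge is enumerated increasingly by `index S`, the triangle by `f`. The map `ψ` translates
-- between them, and the inverse of the relabelling permutation puts the vertices of `t` in place.
restrict-copy : ∀ (t : Tour r) (T : Tour n) {f : Fin (suc r) → Fin n} → Injective _≡_ _≡_ f →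
                ∀ v → image f (∁ ⁅ v ⁆) ∈ edges (copyGraph t T) →
                Copy t (λ i j → arc T (f i) (f j)) v
restrict-copy {r} {n} t T {f} f-inj v e∈ with ∈-map⁻ toSubset e∈
... | S , S∈ , image≡S with satisfied (proj₂ (∈-filter⁻ (λ S → switchingIsomorphic? t (restrict S T)) {xs = choices n r} S∈))
...   | (c , ε) , eq = record
  { vertex    = ψ ∘ π⁻¹
  ; sign      = lookup ε ∘ π⁻¹
  ; injective = π⁻¹-injective ∘ ψ-injective
  ; avoids    = λ i v≡ → x∈∁p⇒x∉p (proj₁ (proj₂ (preimage (π⁻¹ i)))) (subst (_∈ˢ ⁅ v ⁆) v≡ (x∈⁅x⁆ v))
  ; arcs      = λ {i} {j} i≢j → begin
      arc T (f (ψ (π⁻¹ i))) (f (ψ (π⁻¹ j)))       ≡⟨ cong₂ (arc T) (fψ (π⁻¹ i)) (fψ (π⁻¹ j)) ⟩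
      arc T (index S (π⁻¹ i)) (index S (π⁻¹ j))   ≡⟨ sym (arc-restrict S T _ _) ⟩
      arc (restrict S T) (π⁻¹ i) (π⁻¹ j)          ≡⟨ relabel-arc t c ε eq (i≢j ∘ π⁻¹-injective) ⟩
      arc t (decode c ⟨$⟩ʳ π⁻¹ i) (decode c ⟨$⟩ʳ π⁻¹ j) xor (lookup ε (π⁻¹ i) xor lookup ε (π⁻¹ j))
        ≡⟨ cong (_xor (lookup ε (π⁻¹ i) xor lookup ε (π⁻¹ j))) (cong₂ (arc t) (inverseʳ (decode c)) (inverseʳ (decode c))) ⟩
      arc t i j xor (lookup ε (π⁻¹ i) xor lookup ε (π⁻¹ j)) ∎
  }
  where
  open ≡-Reasoning
  π⁻¹ = decode c ⟨$⟩ˡ_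
  π⁻¹-injective : ∀ {i j} → π⁻¹ i ≡ π⁻¹ j → i ≡ j
  π⁻¹-injective e = trans (sym (inverseʳ (decode c))) (trans (cong (decode c ⟨$⟩ʳ_) e) (inverseʳ (decode c)))
  preimage : ∀ i → ∃ λ j → j ∈ˢ ∁ ⁅ v ⁆ × index S i ≡ f j
  preimage i = ∈-image⁻ f (∁ ⁅ v ⁆) (subst (index S i ∈ˢ_) (sym image≡S) (index-∈ˢ S i))
  ψ : Fin r → Fin (suc r)
  ψ i = proj₁ (preimage i)
  fψ : ∀ i → f (ψ i) ≡ index S i
  fψ i = sym (proj₂ (proj₂ (preimage i)))
  ψ-injective : ∀ {i j} → ψ i ≡ ψ j → i ≡ j
  ψ-injective {i} {j} e = index-injective S (trans (sym (fψ i)) (trans (cong f e) (fψ j)))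

-- Replacing a vertex, and triangle-freeness.

delete : Tour (suc r) → Fin (suc r) → Tour r
delete t b = fromMatrix (λ i j → arc t (punchIn b i) (punchIn b j))

-- The rows w such that replacing the vertex b of t by a new vertex, joined to the vertices of t
-- according to w, gives a tournament switching isomorphic to t; the entry of w at b is arbitrary.
replacementsAt : Tour (suc r) → Fin (suc r) → List (Vec Bool (suc r))
replacementsAt t b = cartesianProductWith (λ (v , p) → insertAt (row (arc t) p v) b)
                       (extensions (arc t) (embeddings (arc t) (delete t b))) (true ∷ false ∷ [])

replacements : Tour (suc r) → List (Fin (suc r) × Vec Bool (suc r))
replacements t = deduplicate (Product.≡-dec _≟ᶠ_ (Vec.≡-dec Bool._≟_))
                   (concatMap (λ b → map (b ,_) (replacementsAt t b)) (allFin _))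

-- The old vertices other than `b` go into `t` along `v`, and the new vertex takes the remaining
-- place `x`, whose arcs there prescribe `ω` away from `b`.
∈-replacements : ∀ (t : Tour (suc r)) b (v : Vec _ r) x e ω →
  IsEmbedding (arc t) (delete t b) v → Fresh x v →
  (∀ i → lookup (row (arc t) (x , e) v) i ≡ ω (punchIn b i)) →
  (b , tabulate ω) ∈ replacements t
∈-replacements t b v x e ω emb fr eq = ∈-deduplicate⁺ _ (∈-concatMap⁺ (λ b → map (b ,_) (replacementsAt t b))
  (lose (∈-allFin b) (∈-map⁺ (b ,_) (subst (_∈ replacementsAt t b) ins≡
    (∈-cartesianProductWith⁺ (λ (v , p) → insertAt (row (arc t) p v) b)
      (extensions-complete (arc t) (x , e) (embeddings-complete (arc t) (delete t b) emb) fr) (Bools-complete (ω b)))))))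
  where
  ρ = row (arc t) (x , e) v
  -- The free entry at `b` is chosen to be `ω b`, so that the row agrees with `ω` everywhere.
  pointwise : ∀ i → lookup (insertAt ρ b (ω b)) i ≡ ω i
  pointwise i with b ≟ᶠ i
  ... | yes refl = Vec.insertAt-lookup ρ b (ω b)
  ... | no b≢i   = subst (λ j → lookup (insertAt ρ b (ω b)) j ≡ ω j) (punchIn-punchOut b≢i)
                     (trans (Vec.insertAt-punchIn ρ b (ω b) (punchOut b≢i)) (eq (punchOut b≢i)))
  ins≡ : insertAt ρ b (ω b) ≡ tabulate ω
  ins≡ = trans (sym (Vec.tabulate∘lookup _)) (Vec.tabulate-cong pointwise)

-- A full row determines the replaced vertex. Full rows are compared because the new vertex is
-- joined to all of `t`, the replaced vertex included.
Consistent : List (Fin r × Vec Bool r) → Set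
Consistent L = All (λ (b , w) → All (λ (c , w′) → b ≡ c ⊎ w ≢ w′) L) L

consistent? : (L : List (Fin r × Vec Bool r)) → Dec (Consistent L)
consistent? L = all? (λ (b , w) → all? (λ (c , w′) → (b ≟ᶠ c) ⊎-dec ¬? (Vec.≡-dec Bool._≟_ w w′)) L) L

Consistent-functional : ∀ {L : List (Fin r × Vec Bool r)} {b c w} → Consistent L → (b , w) ∈ L → (c , w) ∈ L → b ≡ c
Consistent-functional cons b∈ c∈ with All.lookup (All.lookup cons b∈) c∈
... | inj₁ b≡c = b≡c
... | inj₂ w≢w = contradiction refl w≢w

module _ {t : Tour (suc r)} {s : Matrix (suc (suc r))} {u : Fin (suc (suc r))} (φ : Copy t s u) where
  private module φ = Copy φ

  -- The arcs from the omitted vertex `u` to `t` in the coordinates of `φ`, with `u` left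
  -- unswitched.
  newRow : Fin (suc r) → Bool
  newRow i = s u (φ.vertex i) xor φ.sign i

  -- The second copy omits `v` and contains `u`, so it is `t` with the vertex `b` at `v` replaced by
  -- `u`. On the r shared vertices `y`, comparing both sets of coordinates embeds `t` minus `b` into
  -- `t`; the new vertex lands at `b′`.
  copy⇒replacement : ∀ {v} → Copy t s v → (u≢v : u ≢ v) → (proj₁ (φ.onto u≢v) , tabulate newRow) ∈ replacements t
  copy⇒replacement {v} ψ u≢v =
    ∈-replacements t b (tabulate (λ i → η i , d i)) b′ (ψ.sign b′) newRow
      (tabulate-isEmbedding (arc t) (delete t b) η d η-injective arcs)
      (VecAll.tabulate⁺ b′-fresh)
      λ i → trans (Vec.lookup-map i _ (tabulate (λ i → η i , d i)))
                  (trans (cong (λ (y , a) → arc t b′ y xor (ψ.sign b′ xor a)) (Vec.lookup∘tabulate (λ i → η i , d i) i))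
                         (rows i))
    where
    module ψ = Copy ψ
    b = proj₁ (φ.onto u≢v)
    y : Fin r → Fin (suc (suc r))
    y i = φ.vertex (punchIn b i)
    v≢y : ∀ i → v ≢ y i
    v≢y i v≡ = punchInᵢ≢i b i (sym (φ.injective (trans (proj₂ (φ.onto u≢v)) v≡)))
    η : Fin r → Fin (suc r)
    η i = proj₁ (ψ.onto (v≢y i))
    η-vertex : ∀ i → ψ.vertex (η i) ≡ y i
    η-vertex i = proj₂ (ψ.onto (v≢y i))
    η-injective : ∀ {i j} → η i ≡ η j → i ≡ j
    η-injective {i} {j} e = punchIn-injective b i j (φ.injective
      (trans (sym (η-vertex i)) (trans (cong ψ.vertex e) (η-vertex j))))
    d : Fin r → Bool
    d i = φ.sign (punchIn b i) xor ψ.sign (η i)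
    arcs : ∀ {i j} → i ≢ j → arc t (η i) (η j) xor (d i xor d j) ≡ arc (delete t b) i j
    arcs {i} {j} i≢j = trans
      (xor-transfer (arc t (punchIn b i) (punchIn b j)) (arc t (η i) (η j))
        (φ.sign (punchIn b i)) (φ.sign (punchIn b j)) (ψ.sign (η i)) (ψ.sign (η j))
        (trans (sym (φ.arcs (i≢j ∘ punchIn-injective b i j)))
               (trans (cong₂ s (sym (η-vertex i)) (sym (η-vertex j))) (ψ.arcs (i≢j ∘ η-injective)))))
      (sym (arc-fromMatrix (λ i≢j → arc-skew t (i≢j ∘ punchIn-injective b _ _)) i≢j))
    b′ = proj₁ (ψ.onto (u≢v ∘ sym))
    b′-vertex : ψ.vertex b′ ≡ u
    b′-vertex = proj₂ (ψ.onto (u≢v ∘ sym))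
    b′-fresh : ∀ i → b′ ≢ η i
    b′-fresh i e = φ.avoids (punchIn b i) (trans (sym b′-vertex) (trans (cong ψ.vertex e) (η-vertex i)))
    rows : ∀ i → arc t b′ (η i) xor (ψ.sign b′ xor d i) ≡ newRow (punchIn b i)
    rows i = begin
      arc t b′ (η i) xor (e xor (a xor c))  ≡⟨ cong (arc t b′ (η i) xor_) (trans (cong (e xor_) (xor-comm a c)) (sym (xor-assoc e c a))) ⟩
      arc t b′ (η i) xor ((e xor c) xor a)  ≡⟨ sym (xor-assoc (arc t b′ (η i)) (e xor c) a) ⟩
      (arc t b′ (η i) xor (e xor c)) xor a  ≡⟨ cong (_xor a) (sym (ψ.arcs (b′-fresh i))) ⟩
      s (ψ.vertex b′) (ψ.vertex (η i)) xor a ≡⟨ cong (_xor a) (cong₂ s b′-vertex (η-vertex i)) ⟩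
      s u (y i) xor a ∎
      where
      open ≡-Reasoning
      e = ψ.sign b′
      a = φ.sign (punchIn b i)
      c = ψ.sign (η i)

-- Seen from the copy omitting `u`, the other two are replacements with the same row, so consistency
-- makes them replace the same vertex.
noThreeCopies : ∀ {t : Tour (suc r)} {s u v w} → Consistent (replacements t) → u ≢ v → u ≢ w → v ≢ w →
                Copy t s u → Copy t s v → ¬ Copy t s w
noThreeCopies cons u≢v u≢w v≢w φ ψ χ = v≢w (trans (sym (proj₂ (Copy.onto φ u≢v)))
  (trans (cong (Copy.vertex φ) (Consistent-functional cons (copy⇒replacement φ ψ u≢v) (copy⇒replacement φ χ u≢w)))
         (proj₂ (Copy.onto φ u≢w))))

copyGraph-free : ∀ {k n} (t : Tour (suc (suc k))) → Consistent (replacements t) → (T : Tour n) →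
                 Free (𝓗 k) (copyGraph t T)
copyGraph-free t cons T (f , f-inj , e₀ ∷ e₁ ∷ e₂ ∷ []) =
  noThreeCopies {t = t} cons (λ ()) (λ ()) (λ ())
    (restrict-copy t T f-inj zero e₀) (restrict-copy t T f-inj (suc zero) e₁) (restrict-copy t T f-inj (suc (suc zero)) e₂)

turán-bound : ∀ {k} (t : Tour (suc (suc k))) {K} .{{_ : NonZero K}} p q → Consistent (replacements t) →
              length (embeddings (arc t) t) ≡ K →
              p * K * tourCount (suc (suc k)) ≤ q * (suc (suc k) ! * 2 ^ suc (suc k)) →
              TuranDensityAtLeast (𝓗 k) p q
-- The density p/q is reached for every n, so the threshold is 0 and the 1/j term is mere slack.
turán-bound {k} t p q cons len le j _ = 0 , λ n _ →
  let T , dense = copyGraph-dense t p q (isomorphs-bound t p q len le) n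
  in copyGraph t T , copyGraph-free t cons T , bound n (numEdges (copyGraph t T)) dense
  where
  open ≤-Reasoning
  bound : ∀ n E → p * (n C suc (suc k)) ≤ q * E → p * j * (n C suc (suc k)) ≤ q * j * E + q * (n C suc (suc k))
  bound n E dense = begin
    p * j * (n C suc (suc k))   ≡⟨ trans (cong (_* (n C suc (suc k))) (*-comm p j)) (*-assoc j p _) ⟩
    j * (p * (n C suc (suc k))) ≤⟨ *-monoʳ-≤ j dense ⟩
    j * (q * E)                 ≡⟨ trans (sym (*-assoc j q E)) (cong (_* E) (*-comm j q)) ⟩
    q * j * E                   ≤⟨ m≤m+n _ _ ⟩
    q * j * E + q * (n C suc (suc k)) ∎

-- Triangle-freeness as a bound on spanned edges.

⊆∧∣∣≥⇒⊇ : ∀ {p q : Subset n} → p ⊆ q → ∣ q ∣ ≤ ∣ p ∣ → q ⊆ p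
⊆∧∣∣≥⇒⊇ {p = p} p⊆q ∣q∣≤∣p∣ {x} x∈q with x ∈? p
... | yes x∈p = x∈p
... | no  x∉p = contradiction (p⊂q⇒∣p∣<∣q∣ (p⊆q , x , x∈q , x∉p)) (≤⇒≯ ∣q∣≤∣p∣)

∣p[x]≔inside∣ : ∀ (p : Subset n) {x} → ¬ (x ∈ˢ p) → ∣ p [ x ]≔ true ∣ ≡ suc ∣ p ∣
∣p[x]≔inside∣ (false ∷ p) {zero}  x∉p = refl
∣p[x]≔inside∣ (true  ∷ p) {zero}  x∉p = contradiction here x∉p
∣p[x]≔inside∣ (false ∷ p) {suc x} x∉p = ∣p[x]≔inside∣ p (x∉p ∘ there)
∣p[x]≔inside∣ (true  ∷ p) {suc x} x∉p = cong suc (∣p[x]≔inside∣ p (x∉p ∘ there))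

spans≤2⇒free : ∀ {k n} (G : RGraph (2 + k) n) → (∀ W → ∣ W ∣ ≡ 3 + k → spans G W ≤ 2) → Free (𝓗 k) G
spans≤2⇒free {k} {n} G spans≤2 (f , f-inj , e₀ ∷ e₁ ∷ e₂ ∷ []) =
  contradiction (≤-trans three (spans≤2 W (trans (∣p[x]≔inside∣ (face zero) (omits zero)) (cong suc (All.lookup (uniform G) e₀)))))
                λ { (s≤s (s≤s ())) }
  where
  face : Fin (3 + k) → Subset n
  face v = image f (∁ ⁅ v ⁆)
  omits : ∀ v → ¬ (f v ∈ˢ face v)
  omits v fv∈ with ∈-image⁻ f (∁ ⁅ v ⁆) fv∈
  ... | i , i∈ , eq = x∈∁p⇒x∉p i∈ (subst (_∈ˢ ⁅ v ⁆) (f-inj eq) (x∈⁅x⁆ v))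
  covers : ∀ {v i} → i ≢ v → f i ∈ˢ face v
  covers {v} i≢v = ∈-image⁺ f (∁ ⁅ v ⁆) (x∉p⇒x∈∁p (x≢y⇒x∉⁅y⁆ i≢v))
  -- The vertex set of the triangle, written as one edge plus the vertex it misses so that
  -- uniformity gives its size.
  W = face zero [ f zero ]≔ true
  f∈W : ∀ i → f i ∈ˢ W
  f∈W i with i ≟ᶠ zero
  ... | yes refl = Vec.[]≔-updates (face zero) (f zero)
  ... | no  i≢0  = Vec.[]≔-minimal (face zero) (f i) (f zero) (i≢0 ∘ f-inj) (covers i≢0)
  face⊆W : ∀ v → face v ⊆ W
  face⊆W v x∈ with ∈-image⁻ f (∁ ⁅ v ⁆) x∈
  ... | i , _ , refl = f∈W i
  face-injective : ∀ v w → v ≢ w → face v ≢ face w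
  face-injective v w v≢w eq = omits v (subst (f v ∈ˢ_) (sym eq) (covers v≢w))
  spanned : ∀ {e} → e ∈ face zero ∷ face (suc zero) ∷ face (suc (suc zero)) ∷ [] → e ∈ filter (_⊆? W) (edges G)
  spanned (here refl)                 = ∈-filter⁺ (_⊆? W) e₀ (face⊆W zero)
  spanned (there (here refl))         = ∈-filter⁺ (_⊆? W) e₁ (face⊆W (suc zero))
  spanned (there (there (here refl))) = ∈-filter⁺ (_⊆? W) e₂ (face⊆W (suc (suc zero)))
  three : 3 ≤ spans G W
  three = Unique-⊆-length
    ((face-injective zero (suc zero) (λ ()) ∷ face-injective zero (suc (suc zero)) (λ ()) ∷ [])
      ∷ (face-injective (suc zero) (suc (suc zero)) (λ ()) ∷ []) ∷ [] ∷ []) spanned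

record Facet (e W : Subset n) : Set where
  field
    apex   : Fin n
    apex∈W : apex ∈ˢ W
    apex∉e : ¬ (apex ∈ˢ e)
    e⊆W    : e ⊆ W
    rest∈e : ∀ {x} → x ∈ˢ W → x ≢ apex → x ∈ˢ e

facet : ∀ {e W : Subset n} → e ⊆ W → ∣ W ∣ ≡ suc ∣ e ∣ → Facet e W
facet {e = e} {W} e⊆W ∣W∣ with any? (λ x → (x ∈? W) ×-dec ¬? (x ∈? e))
... | yes (a , a∈W , a∉e) = record
  { apex   = a
  ; apex∈W = a∈W
  ; apex∉e = a∉e
  ; e⊆W    = e⊆W
  ; rest∈e = λ x∈W x≢a → ⊆∧∣∣≥⇒⊇ {p = e} {W - a}
      (λ {x} x∈e → x∈p∧x≢y⇒x∈p-y (e⊆W x∈e) (λ { refl → a∉e x∈e }))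
      (≤-pred (subst (∣ W - a ∣ <_) ∣W∣ (x∈p⇒∣p-x∣<∣p∣ a∈W)))
      (x∈p∧x≢y⇒x∈p-y x∈W x≢a)
  }
... | no none = contradiction (subst (_≤ ∣ e ∣) ∣W∣ (p⊆q⇒∣p∣≤∣q∣ W⊆e)) 1+n≰n
  where
  W⊆e : W ⊆ e
  W⊆e {x} x∈W with x ∈? e
  ... | yes x∈e = x∈e
  ... | no  x∉e = contradiction (x , x∈W , x∉e) none

apex-injective : ∀ {e e′ W : Subset n} (F : Facet e W) (F′ : Facet e′ W) → e ≢ e′ → Facet.apex F ≢ Facet.apex F′
apex-injective F F′ e≢e′ eq = e≢e′ (⊆-antisym (incl F F′ eq) (incl F′ F (sym eq)))
  where
  incl : ∀ {e e′ W : Subset n} (F : Facet e W) (F′ : Facet e′ W) → Facet.apex F ≡ Facet.apex F′ → e ⊆ e′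
  incl F F′ eq x∈e = Facet.rest∈e F′ (Facet.e⊆W F x∈e) (λ x≡ → Facet.apex∉e F (subst (_∈ˢ _) (trans x≡ (sym eq)) x∈e))

-- The edges of `𝓗` omit the vertices 0, 1, 2, which must be moved to three given apexes. Insertion
-- builds the permutation, `punchOut` renumbering the targets as earlier ones are used up.
permutation-3-transitive : ∀ {n} {a b c : Fin (3 + n)} → a ≢ b → a ≢ c → b ≢ c →
  ∃ λ (π : Permutation′ (3 + n)) → π ⟨$⟩ʳ zero ≡ a × π ⟨$⟩ʳ suc zero ≡ b × π ⟨$⟩ʳ suc (suc zero) ≡ c
permutation-3-transitive {n} {a} {b} {c} a≢b a≢c b≢c =
  insert zero a π₁ , refl
  , trans (insert-punchIn zero a π₁ zero) (punchIn-punchOut a≢b)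
  , trans (insert-punchIn zero a π₁ (suc zero))
          (trans (cong (punchIn a) (trans (insert-punchIn zero b′ π₂ zero) (punchIn-punchOut b′≢c′))) (punchIn-punchOut a≢c))
  where
  b′ = punchOut a≢b
  c′ = punchOut a≢c
  b′≢c′ : b′ ≢ c′
  b′≢c′ = b≢c ∘ punchOut-injective a≢b a≢c
  π₂ = insert zero (punchOut b′≢c′) (idₚ {n})
  π₁ = insert zero b′ π₂

index-surjective : ∀ (S : Choice n k) {x} → x ∈ˢ toSubset S → ∃ λ i → index S i ≡ x
index-surjective (take S) here       = zero , refl
index-surjective (take S) (there x∈) with index-surjective S x∈
... | i , eq = suc i , cong suc eq
index-surjective (skip S) (there x∈) with index-surjective S x∈
... | i , eq = i , cong suc eq

image-facet : ∀ {r} (S : Choice n (suc r)) (π : Permutation′ (suc r)) {e} (F : Facet e (toSubset S)) v →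
              index S (π ⟨$⟩ʳ v) ≡ Facet.apex F → image (λ i → index S (π ⟨$⟩ʳ i)) (∁ ⁅ v ⁆) ≡ e
image-facet S π {e} F v f-v = ⊆-antisym to from
  where
  open Facet F
  f = λ i → index S (π ⟨$⟩ʳ i)
  to : image f (∁ ⁅ v ⁆) ⊆ e
  to x∈ with ∈-image⁻ f (∁ ⁅ v ⁆) x∈
  ... | i , i∈ , refl = rest∈e (index-∈ˢ S _) λ f-i →
    x∈∁p⇒x∉p i∈ (subst (_∈ˢ ⁅ v ⁆) (permutation-injective π (index-injective S (trans f-v (sym f-i)))) (x∈⁅x⁆ v))
  from : e ⊆ image f (∁ ⁅ v ⁆)
  from x∈e with index-surjective S (e⊆W x∈e)
  ... | j , refl = subst (λ i → index S i ∈ˢ image f (∁ ⁅ v ⁆)) (inverseʳ π) (∈-image⁺ f (∁ ⁅ v ⁆)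
    (x∉p⇒x∈∁p (x≢y⇒x∉⁅y⁆ λ j≡v → apex∉e (subst (_∈ˢ e)
      (trans (cong (index S) (trans (sym (inverseʳ π)) (cong (π ⟨$⟩ʳ_) j≡v))) f-v) x∈e))))

facets⇒copy : ∀ {k} (G : RGraph (2 + k) n) (S : Choice n (3 + k)) {e₀ e₁ e₂} →
              e₀ ≢ e₁ → e₀ ≢ e₂ → e₁ ≢ e₂ →
              Facet e₀ (toSubset S) → Facet e₁ (toSubset S) → Facet e₂ (toSubset S) →
              e₀ ∈ edges G → e₁ ∈ edges G → e₂ ∈ edges G → ContainsCopy G (𝓗 k)
facets⇒copy {n} {k} G S e₀≢e₁ e₀≢e₂ e₁≢e₂ F₀ F₁ F₂ e₀∈ e₁∈ e₂∈ =
  copyAlong (permutation-3-transitive (apart F₀ F₁ e₀≢e₁) (apart F₀ F₂ e₀≢e₂) (apart F₁ F₂ e₁≢e₂))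
  where
  position : ∀ {e} (F : Facet e (toSubset S)) → ∃ λ i → index S i ≡ Facet.apex F
  position F = index-surjective S (Facet.apex∈W F)
  apart : ∀ {e e′} (F : Facet e (toSubset S)) (F′ : Facet e′ (toSubset S)) → e ≢ e′ →
          proj₁ (position F) ≢ proj₁ (position F′)
  apart F F′ e≢e′ eq = apex-injective F F′ e≢e′
    (trans (sym (proj₂ (position F))) (trans (cong (index S) eq) (proj₂ (position F′))))
  placed : ∀ (π : Permutation′ (3 + k)) {e} (F : Facet e (toSubset S)) v →
           π ⟨$⟩ʳ v ≡ proj₁ (position F) → e ∈ edges G →
           image (λ i → index S (π ⟨$⟩ʳ i)) (∁ ⁅ v ⁆) ∈ edges G
  placed π F v πv e∈ = subst (_∈ edges G)
    (sym (image-facet S π F v (trans (cong (index S) πv) (proj₂ (position F))))) e∈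
  copyAlong : (∃ λ (π : Permutation′ (3 + k)) → π ⟨$⟩ʳ zero ≡ proj₁ (position F₀)
                × π ⟨$⟩ʳ suc zero ≡ proj₁ (position F₁) × π ⟨$⟩ʳ suc (suc zero) ≡ proj₁ (position F₂)) →
              ContainsCopy G (𝓗 k)
  copyAlong (π , π0 , π1 , π2) =
    (λ i → index S (π ⟨$⟩ʳ i)) , permutation-injective π ∘ index-injective S ,
    placed π F₀ zero π0 e₀∈ ∷ placed π F₁ (suc zero) π1 e₁∈ ∷ placed π F₂ (suc (suc zero)) π2 e₂∈ ∷ []

-- An edge inside a set with one more vertex is a facet of it, and any three distinct facets of one
-- set form a triangle.
free⇒spans≤2 : ∀ {k n} (G : RGraph (2 + k) n) → Free (𝓗 k) G → (S : Choice n (3 + k)) → spans G (toSubset S) ≤ 2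
free⇒spans≤2 {k} {n} G free S =
  bound (filter (_⊆? W) (edges G)) (∈-filter⁻ (_⊆? W)) (Uniq.filter⁺ (_⊆? W) (distinct G))
  where
  W = toSubset S
  facetOf : ∀ {e} → e ∈ edges G × e ⊆ W → Facet e W
  facetOf (e∈ , e⊆W) = facet e⊆W (trans (∣toSubset∣ S) (cong suc (sym (All.lookup (uniform G) e∈))))
  bound : ∀ es → (∀ {e} → e ∈ es → e ∈ edges G × e ⊆ W) → Unique es → length es ≤ 2
  bound []           _ _ = z≤n
  bound (_ ∷ [])     _ _ = s≤s z≤n
  bound (_ ∷ _ ∷ []) _ _ = s≤s (s≤s z≤n)
  bound (e₀ ∷ e₁ ∷ e₂ ∷ _) mem ((e₀≢e₁ ∷ e₀≢e₂ ∷ _) ∷ (e₁≢e₂ ∷ _) ∷ _) = contradiction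
    (facets⇒copy G S e₀≢e₁ e₀≢e₂ e₁≢e₂ (facetOf e₀∈) (facetOf e₁∈) (facetOf e₂∈) (proj₁ e₀∈) (proj₁ e₁∈) (proj₁ e₂∈))
    free
    where
    e₀∈ = mem (here refl)
    e₁∈ = mem (there (here refl))
    e₂∈ = mem (there (there (here refl)))

-- Double counting for the upper bound.

supersets : Subset n → ℕ → ℕ
supersets {n} e k = ∑ (choices n k) (λ S → ⟦ e ⊆? toSubset S ⟧)

1≤supersets : (e : Subset n) → 1 ≤ supersets e ∣ e ∣
1≤supersets e with fromSubset e
... | S , eq = ∈⇒1≤∑ (λ S → e ⊆? toSubset S) (choices-complete S) (⊆-reflexive (sym eq))

-- Each position outside `e` gives a superset with one more point. The additive form suits induction
-- over the positions.
n≤∣e∣+supersets : (e : Subset n) → n ≤ ∣ e ∣ + supersets e (suc ∣ e ∣)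
n≤∣e∣+supersets []          = z≤n
n≤∣e∣+supersets {suc n} (true ∷ e) = s≤s (≤-trans (n≤∣e∣+supersets e) (+-monoʳ-≤ ∣ e ∣ (begin
  supersets e (suc ∣ e ∣) ≡⟨ sym (∑-map take (choices n (suc ∣ e ∣)) _) ⟩
  ∑ (map take (choices n (suc ∣ e ∣))) (λ S → ⟦ (true ∷ e) ⊆? toSubset S ⟧) ≤⟨ m≤m+n _ _ ⟩
  _ ≡⟨ sym (∑-++ (map take (choices n (suc ∣ e ∣))) _) ⟩
  supersets (true ∷ e) (suc (suc ∣ e ∣)) ∎)))
  where open ≤-Reasoning
n≤∣e∣+supersets {suc n} (false ∷ e) = begin
  suc n                                                   ≤⟨ s≤s (n≤∣e∣+supersets e) ⟩
  suc (∣ e ∣ + supersets e (suc ∣ e ∣))                   ≡⟨ sym (+-suc ∣ e ∣ _) ⟩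
  -- The extra superset is `e` together with the present position.
  ∣ e ∣ + (1 + supersets e (suc ∣ e ∣))                   ≤⟨ +-monoʳ-≤ ∣ e ∣ (+-monoˡ-≤ _ (1≤supersets e)) ⟩
  ∣ e ∣ + (supersets e ∣ e ∣ + supersets e (suc ∣ e ∣))
    ≡⟨ cong (∣ e ∣ +_) (sym (trans (∑-++ (map take (choices n ∣ e ∣)) _)
         (cong₂ _+_ (∑-map take (choices n ∣ e ∣) _) (∑-map skip (choices n (suc ∣ e ∣)) _)))) ⟩
  ∣ e ∣ + supersets (false ∷ e) (suc ∣ e ∣)               ∎
  where open ≤-Reasoning

-- Counts the pairs of an edge and a (3 + k)-set containing it: every edge has at least n - (2 + k)
-- such sets, every set at most two edges.
free⇒edge-bound : ∀ {k n} (G : RGraph (2 + k) n) → Free (𝓗 k) G →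
                  numEdges G * (n ∸ (2 + k)) ≤ (n C (3 + k)) * 2
free⇒edge-bound {k} {n} G free = begin
  numEdges G * (n ∸ (2 + k))                   ≡⟨ sym (∑-const (edges G) _) ⟩
  ∑ (edges G) (λ _ → n ∸ (2 + k))              ≤⟨ ∑-mono-All (All.map (λ {e} → degree {e}) (uniform G)) ⟩
  ∑ (edges G) (λ e → supersets e (3 + k))      ≡⟨ ∑-swap (edges G) (choices n (3 + k)) _ ⟩
  ∑ (choices n (3 + k)) (λ S → ∑ (edges G) (λ e → ⟦ e ⊆? toSubset S ⟧))
    ≡⟨ ∑-cong (choices n (3 + k)) (λ S → sym (length-filter≡∑ (_⊆? toSubset S) (edges G))) ⟩
  ∑ (choices n (3 + k)) (λ S → spans G (toSubset S)) ≤⟨ ∑-mono (choices n (3 + k)) (free⇒spans≤2 G free) ⟩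
  ∑ (choices n (3 + k)) (λ _ → 2)              ≡⟨ ∑-const (choices n (3 + k)) 2 ⟩
  length (choices n (3 + k)) * 2               ≡⟨ cong (_* 2) (length-choices n (3 + k)) ⟩
  (n C (3 + k)) * 2                            ∎
  where
  open ≤-Reasoning
  degree : ∀ {e : Subset n} → ∣ e ∣ ≡ 2 + k → n ∸ (2 + k) ≤ supersets e (3 + k)
  degree {e} ∣e∣ = m≤n+o⇒m∸n≤o n (2 + k) (subst (λ m → n ≤ m + supersets e (suc m)) ∣e∣ (n≤∣e∣+supersets e))

-- The explicit tournaments and the density bounds.

-- T6, T7 and T8 were found by a computer search through the switching classes of tournaments.
pattern I = true
pattern O = false

T6 : Tour 6
T6 = (I ∷ I ∷ I ∷ I ∷ I ∷ []) , (I ∷ I ∷ I ∷ O ∷ []) , (I ∷ I ∷ I ∷ []) , (I ∷ O ∷ []) , (I ∷ []) , [] , tt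

T7 : Tour 7
T7 = (I ∷ I ∷ I ∷ I ∷ I ∷ O ∷ []) , (I ∷ I ∷ I ∷ O ∷ O ∷ []) , (I ∷ I ∷ I ∷ I ∷ []) , (I ∷ I ∷ O ∷ []) , (I ∷ I ∷ []) , (I ∷ []) , [] , tt

T8 : Tour 8
T8 = (I ∷ I ∷ I ∷ I ∷ I ∷ I ∷ I ∷ []) , (I ∷ I ∷ I ∷ I ∷ O ∷ I ∷ []) , (I ∷ I ∷ I ∷ I ∷ O ∷ []) , (I ∷ I ∷ I ∷ I ∷ []) , (I ∷ I ∷ O ∷ []) , (I ∷ I ∷ []) , (I ∷ []) , [] , tt

turán₆ : TuranDensityAtLeast (𝓗 4) 9 64
-- Evaluation confirms the 10 automorphisms, and the last inequality is the equality 9 · 10 · 2^15 =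
-- 64 · 6! · 2^6.
turán₆ = turán-bound T6 {10} 9 64 (toWitness {a? = consistent? (replacements T6)} _) refl (≤-reflexive refl)

turán₇ : TuranDensityAtLeast (𝓗 5) 35 (2 ^ 11)
turán₇ = turán-bound T7 {18} 35 (2 ^ 11) (toWitness {a? = consistent? (replacements T7)} _) refl (≤-reflexive refl)

turán₈ : TuranDensityAtLeast (𝓗 6) 315 (2 ^ 14)
turán₈ = turán-bound T8 {2} 315 (2 ^ 14) (toWitness {a? = consistent? (replacements T8)} _) refl (≤-reflexive refl)

-- The design on 12 points and its extremality.

-- fromMatrix reads only the entries above the diagonal, so the other entries of arcs are irrelevant.
Paley : Tour 12
Paley = fromMatrix arcs
  where
  isSquare : ℕ → Bool
  isSquare d = (d ≡ᵇ 1) ∨ (d ≡ᵇ 3) ∨ (d ≡ᵇ 4) ∨ (d ≡ᵇ 5) ∨ (d ≡ᵇ 9)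
  arcs : Matrix 12
  arcs zero    j       = true
  arcs (suc i) zero    = false
  arcs (suc i) (suc j) = isSquare (toℕ j ∸ toℕ i)

-- Switching so that vertex 0 dominates turns the other three vertices into a directed cycle.
cyclic : Tour 4 → Bool
cyclic ((a ∷ b ∷ c ∷ []) , (d ∷ e ∷ []) , (f ∷ []) , [] , tt) =
  not (t₁₂ xor t₂₃) ∧ (t₂₃ xor t₁₃)
  where
  t₁₂ = a xor b xor d
  t₁₃ = a xor c xor e
  t₂₃ = b xor c xor f

-- A quadruple is cyclic exactly when its skew matrix of signs has Pfaffian 3 or -3 rather than 1 or
-- -1, so the count is invariant under switching and relabelling.
cyclicQuadruples : Tour n → ℕ
cyclicQuadruples {n} t = length (filter (λ Q → cyclic (restrict Q t) Bool.≟ true) (choices n 4))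

-- In Paley the 6-sets switching isomorphic to T6 are those with five cyclic quadruples, a cheaper test.
design : RGraph 6 12
design = hypergraph (λ S → cyclicQuadruples (restrict S Paley) ≟ 5)

numEdges-design : numEdges design ≡ 264
numEdges-design = refl

-- The edge list is an argument so that evaluation shares it between all the sets.
degrees? : ∀ k d (es : List (Subset n)) →
  Dec (All (λ (S : Choice n k) → length (filter (λ e → toSubset S ⊆? e) es) ≡ d) (choices n k))
degrees? k d es = all? (λ S → length (filter (λ e → toSubset S ⊆? e) es) ≟ d) (choices _ k)

spans? : ∀ k c d (es : List (Subset n)) →
  Dec (All (λ (S : Choice n k) → length (filter (λ e → e ⊆? toSubset S) es) ≡ c
                               ⊎ length (filter (λ e → e ⊆? toSubset S) es) ≡ d) (choices n k))
spans? k c d es = all? (λ S → (length (filter (λ e → e ⊆? toSubset S) es) ≟ c)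
                         ⊎-dec (length (filter (λ e → e ⊆? toSubset S) es) ≟ d)) (choices _ k)

degrees-design : All (λ (S : Choice 12 5) → degreeOf design (toSubset S) ≡ 2) (choices 12 5)
degrees-design = toWitness {a? = degrees? 5 2 (edges design)} _

spans-design : All (λ (S : Choice 12 7) → spans design (toSubset S) ≡ 0 ⊎ spans design (toSubset S) ≡ 2) (choices 12 7)
spans-design = toWitness {a? = spans? 7 0 2 (edges design)} _

All-choices : ∀ {P : Subset n → Set} → All (P ∘ toSubset) (choices n k) → ∀ p → ∣ p ∣ ≡ k → P p
All-choices {P = P} ps p refl with fromSubset p
... | S , eq = subst P eq (All.lookup ps (choices-complete S))

design-isDesign : IsDesign 5 12 6 2 design
design-isDesign = All-choices degrees-design

design-spans : ∀ S → ∣ S ∣ ≡ 7 → spans design S ≡ 0 ⊎ spans design S ≡ 2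
design-spans = All-choices spans-design

design-free : Free (𝓗 4) design
design-free = spans≤2⇒free design λ W ∣W∣ → ≤2 (design-spans W ∣W∣)
  where
  ≤2 : ∀ {m} → m ≡ 0 ⊎ m ≡ 2 → m ≤ 2
  ≤2 (inj₁ refl) = z≤n
  ≤2 (inj₂ refl) = ≤-refl

ex₁₂ : ExEq (𝓗 4) 12 264
-- For 12 vertices the edge bound reads 6 |E| ≤ 2 · 792 = 264 · 6.
ex₁₂ = (design , design-free , numEdges-design) , λ G free → *-cancelʳ-≤ (numEdges G) 264 6 (free⇒edge-bound G free)

theorem1p1 : TuranDensityAtLeast (𝓗 4) 9 64
    × TuranDensityAtLeast (𝓗 5) 35 (2 ^ 11)
    × TuranDensityAtLeast (𝓗 6) 315 (2 ^ 14)
    × Σ (RGraph 6 12) (λ D → IsDesign 5 12 6 2 D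
    × ((S : Subset 12) → ∣ S ∣ ≡ 7 → (spans D S ≡ 0) ⊎ (spans D S ≡ 2)))
    × ExEq (𝓗 4) 12 264
theorem1p1 = turán₆ , turán₇ , turán₈ , (design , design-isDesign , design-spans) , ex₁₂
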